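{- For any weak composition $a$ of length $n$, \[ \overline{\mathfrak{A}}_a^{(\beta)}=\sum_{T\in\overline{\mathfrak{A}}2\overline{\mathfrak{P}}(a)}\beta^{|T|-|a|}\,\overline{\mathfrak{P}}_{\mathrm{wt}(T)}^{(\beta)}, \] where $\overline{\mathfrak{A}}2\overline{\mathfrak{P}}(a)$ is the set of meson-highest semistandard set-valued skyline fillings of shape $a$. In particular, every Lascoux atom $\overline{\mathfrak{A}}_a$ is a positive sum of kaons.
   Context: Fix $n\ge1$; $\beta$ is a formal parameter. A weak composition of length $n$ is a sequence $a=(a_1,\dots,a_n)$ of nonnegative integers, $|a|=\sum_i a_i$, and $\mathbf{x}^a=x_1^{a_1}\cdots x_n^{a_n}$. Lascoux atoms. The skyline diagram $D(a)$ has $a_i$ left-justified boxes in row $i$; row $1$ is the lowest row. A triple consists of three boxes, two of them adjacent in a row (left box with entry $\beta'$, right box with entry $\alpha'$) and a third box with entry $\gamma'$, such that either (Type A) the third box is above the right box, in the same column as it, and the lower of the two rows is weakly longer, or (Type B) the third box is below the left box, in the same column as it, and the higher of the two rows is strictly longer. A triple is an inversion triple if $\gamma'<\alpha'\le\beta'$ or $\alpha'\le\beta'<\gamma'$. A set-valued filling assigns a nonempty set of positive integers to each box; the maximum of each box is its anchor, all other entries are free. It is semistandard if (S.1) entries do not repeat in a column; (S.2) rows are weakly decreasing from left to right, where $A\ge B$ means $\min A\ge\max B$; (S.3) every triple of anchors is an inversion triple; (S.4) each free entry is in the cell of the least anchor in its column such that (S.2) is not violated (i.e. among the cells of its column with larger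 anchor in which it could be placed without violating (S.2), it is in the one with least anchor); (S.5) anchors in the first column equal their row index. Let $\overline{\mathfrak{A}}\mathsf{SSF}(a)$ be the set of semistandard set-valued fillings of $D(a)$. For a filling $F$, $\mathrm{wt}(F)=(c_1,\dots,c_n)$ with $c_i$ the number of $i$'s in $F$, $|F|=|\mathrm{wt}(F)|$ is the total number of entries, and $\mathrm{ex}(F)=|F|-|a|$ is the number of free entries. The Lascoux atom is $\overline{\mathfrak{A}}_a^{(\beta)}=\sum_{F\in\overline{\mathfrak{A}}\mathsf{SSF}(a)}\beta^{\mathrm{ex}(F)}\mathbf{x}^{\mathrm{wt}(F)}$. Meson-highest. $T\in\overline{\mathfrak{A}}\mathsf{SSF}(a)$ is meson-highest if, for every integer $i$ appearing in $T$, either the leftmost $i$ is in the leftmost column and is an anchor, or there is an $i^\uparrow$ in some column weakly to the right of the leftmost $i$ and in a different box, where $i^\uparrow$ is the smallest label greater than $i$ appearing in $T$. Kaons. A weak komposition is a weak composition whose positive entries are each colored black or red (different colorings are different weak kompositions); its excess $\mathrm{ex}$ is the number of red entries. Let $a$ have nonzero entries exactly in positions $n_1<\dots<n_\ell$, and put $n_0=0$. A weak komposition $b$ of length $n$ is a mesonic glide of $a$ if $b_k=0$ for $k>n_\ell$ and, for each $1\le j\le\ell$: $a_{n_j}=b_{n_{j-1}+1}+\dots+b_{n_j}-\mathrm{ex}(b_{n_{j-1}+1},\dots,b_{n_j})$; the leftmost nonzero entry among $b_{n_{j-1}+1},\dots,b_{n_j}$ is black; and $b_{n_j}\ne0$.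 The kaon is $\overline{\mathfrak{P}}_a^{(\beta)}=\sum_b\beta^{\mathrm{ex}(b)}\mathbf{x}^b$ over all mesonic glides $b$ of $a$. -}

module Defs where

open import Data.Bool using (Bool; true; false; if_then_else_)
open import Data.Fin using (Fin; zero; suc; toℕ; inject₁; _<_; _≤_)
open import Data.Fin.Properties as Fin using (_≟_; _<?_; _≤?_; all?; any?)
open import Data.Fin.Subset using (Subset; inside; outside; ⁅_⁆; _∪_; _∈_; Nonempty)
open import Data.Fin.Subset.Properties using (_∈?_; nonempty?; drop-there)
open import Data.Integer as ℤ using (ℤ; 0ℤ; 1ℤ)
open import Data.List as List
  using (List; []; _∷_; [_]; _++_; cartesianProductWith; filter; foldr; length; allFin; upTo; concatMap)
open import Data.List.Membership.Propositional as L using ()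
open import Data.List.Membership.Propositional.Properties
  using (∈-cartesianProductWith⁺; ∈-filter⁺; ∈-filter⁻; ∈-allFin; ∈-upTo⁺)
open import Data.List.Relation.Unary.All as LAll using ()
open import Data.List.Relation.Unary.AllPairs as AllPairs using ()
open import Data.List.Relation.Unary.Any using (here; there)
open import Data.List.Relation.Unary.Unique.Propositional using (Unique)
open import Data.List.Relation.Unary.Unique.Propositional.Properties as Unique using ()
open import Data.Nat as ℕ using (ℕ; zero; suc; _+_; _∸_; z≤n; s≤s)
open import Data.Nat.ListAction using (sum)
import Data.Nat.Properties as ℕ
open import Data.Product using (Σ; Σ-syntax; ∃; ∃-syntax; _×_; _,_; proj₁; proj₂)
import Data.Product.Properties as Product
open import Data.Sum using (_⊎_)
open import Data.Vec as Vec using (Vec; []; _∷_; lookup; tabulate; zipWith; replicate)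
import Data.Vec.Properties as Vec
open import Data.Vec.Relation.Unary.All using (All; []; _∷_)
open import Data.Vec.Relation.Unary.All.Properties using (lookup⁺)
open import Function using (_∘_)
open import Relation.Binary.PropositionalEquality
  using (_≡_; _≢_; refl; sym; trans; cong; subst)
open import Relation.Nullary using (¬_; Dec; yes; no; does; contradiction)
open import Relation.Nullary.Decidable using (map′; ¬?; _×-dec_; _⊎-dec_; _→-dec_)

private
  variable
    n N : ℕ
    A : Set

------------------------------------------------------------------------
-- The polynomial ring ℤ[β][x₁,…,xₙ]

-- (k , e) stands for β^k x^e.
Monomial : ℕ → Set
Monomial n = ℕ × Vec ℕ n

_≟ᵐ_ : (m m′ : Monomial n) → Dec (m ≡ m′)
_≟ᵐ_ = Product.≡-dec ℕ._≟_ (Vec.≡-dec ℕ._≟_)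

-- Formal sums of terms, possibly with repeated monomials or zero
-- coefficients; the equality of polynomials is _≈_ below, not _≡_.
Poly : ℕ → Set
Poly n = List (ℤ × Monomial n)

coeff : Poly n → Monomial n → ℤ
coeff p m = foldr (λ (c , m′) s → if does (m ≟ᵐ m′) then c ℤ.+ s else s) 0ℤ p

infix 4 _≈_
_≈_ : Poly n → Poly n → Set
p ≈ q = ∀ m → coeff p m ≡ coeff q m

infixl 6 _⊕_
_⊕_ : Poly n → Poly n → Poly n
_⊕_ = _++_

infixl 7 _⊗_
_⊗_ : Poly n → Poly n → Poly n
_⊗_ = cartesianProductWith
  λ (c , k , e) (c′ , k′ , e′) → c ℤ.* c′ , k + k′ , zipWith _+_ e e′

β^_ : ℕ → Poly n
β^ k = [ 1ℤ , k , replicate _ 0 ]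

𝐱^_ : Vec ℕ n → Poly n
𝐱^ e = [ 1ℤ , 0 , e ]

∑ : List A → (A → Poly n) → Poly n
∑ xs f = foldr (λ x p → f x ⊕ p) [] xs

syntax ∑ xs (λ x → p) = ∑[ x ← xs ] p

------------------------------------------------------------------------
-- Skyline diagrams and set-valued fillings

∣_∣ : Vec ℕ n → ℕ
∣_∣ = Vec.sum

record Box (a : Vec ℕ n) : Set where
  constructor ⟨_,_⟩
  field
    row      : Fin n
    position : Fin (lookup a row)

  col rowLength : ℕ
  col       = toℕ position
  rowLength = lookup a row

open Box using (row; col; rowLength)

module _ {a : Vec ℕ n} where

  _≟ᵇ_ : (b b′ : Box a) → Dec (b ≡ b′)
  ⟨ i , j ⟩ ≟ᵇ ⟨ i′ , j′ ⟩ = map′ (λ { refl → refl }) (λ { refl → refl })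
    (Product.≡-dec _≟_ _≟_ (i , j) (i′ , j′))

  allBox? : {P : Box a → Set} → (∀ b → Dec (P b)) → Dec (∀ b → P b)
  allBox? P? = map′ (λ f (⟨ i , j ⟩) → f i j) (λ f i j → f ⟨ i , j ⟩)
    (all? λ i → all? λ j → P? ⟨ i , j ⟩)

  anyBox? : {P : Box a → Set} → (∀ b → Dec (P b)) → Dec (∃ P)
  anyBox? P? = map′ (λ (i , j , p) → ⟨ i , j ⟩ , p) (λ (⟨ i , j ⟩ , p) → i , j , p)
    (any? λ i → any? λ j → P? ⟨ i , j ⟩)

boxes : (a : Vec ℕ n) → List (Box a)
boxes a = concatMap (λ i → List.map ⟨ i ,_⟩ (allFin (lookup a i))) (allFin _)

-- A set-valued filling with entries among 1,…,N: x : Fin N stands for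
-- the positive integer toℕ x + 1, just as i : Fin n stands for row
-- toℕ i + 1.  Boxes are required to be nonempty in Semistandard.
Filling : ℕ → Vec ℕ n → Set
Filling N a = All (Vec (Subset N)) a

infix 8 _at_
_at_ : {a : Vec ℕ n} → Filling N a → Box a → Subset N
F at ⟨ i , j ⟩ = lookup (lookup⁺ F i) j

IsMax : Fin N → Subset N → Set
IsMax x S = x ∈ S × (∀ y → y ∈ S → y ≤ x)

IsMin : Fin N → Subset N → Set
IsMin x S = x ∈ S × (∀ y → y ∈ S → x ≤ y)

IsAnchor : Fin N → Subset N → Set
IsAnchor = IsMax

IsFree : Fin N → Subset N → Set
IsFree x S = x ∈ S × ¬ IsAnchor x S

_≽_ : Subset N → Subset N → Set
A ≽ B = ∀ x y → IsMin x A → IsMax y B → y ≤ x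

-- α, β and γ are the entries of the right, left and third box.
Inversion : (α β γ : Fin N) → Set
Inversion α β γ = (γ < α × α ≤ β) ⊎ (α ≤ β × β < γ)

module _ {a : Vec ℕ n} where

  Adjacent : (left right : Box a) → Set
  Adjacent l r = row l ≡ row r × col r ≡ suc (col l)

  -- Larger row indices are higher.
  TypeA TypeB Triple : (left right third : Box a) → Set
  TypeA l r t = row r < row t × col t ≡ col r × rowLength t ℕ.≤ rowLength r
  TypeB l r t = row t < row l × col t ≡ col l × rowLength t ℕ.< rowLength l
  Triple l r t = Adjacent l r × (TypeA l r t ⊎ TypeB l r t)

  RowsDecreasing : (Box a → Subset N) → Set
  RowsDecreasing T = ∀ l r → Adjacent l r → T l ≽ T r

  insert : (Box a → Subset N) → Box a → Fin N → (Box a → Subset N)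
  insert T b x b′ = if does (b ≟ᵇ b′) then ⁅ x ⁆ ∪ T b′ else T b′

  ColumnsDistinct : Filling N a → Set
  ColumnsDistinct F = ∀ b b′ x → col b ≡ col b′ → x ∈ F at b → x ∈ F at b′ → b ≡ b′

  AnchorsInverted : Filling N a → Set
  AnchorsInverted F = ∀ l r t → Triple l r t → ∀ α β γ →
    IsAnchor α (F at r) → IsAnchor β (F at l) → IsAnchor γ (F at t) → Inversion α β γ

  -- A free entry x of b fits in no box b′ of its column whose anchor m′
  -- is larger than x and smaller than the anchor m of b.  It makes no
  -- difference that x is tried in b′ without being taken out of b: the
  -- row of b is decreasing either way.
  FreeLeast : Filling N a → Set
  FreeLeast F = ∀ b b′ → col b ≡ col b′ → ∀ x m m′ →
    IsFree x (F at b) → IsAnchor m (F at b) → IsAnchor m′ (F at b′) → x < m′ → m′ < m →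
    ¬ RowsDecreasing (insert (F at_) b′ x)

  FirstColumnAnchored : Filling N a → Set
  FirstColumnAnchored F = ∀ b → col b ≡ 0 → ∀ x → IsAnchor x (F at b) → toℕ x ≡ toℕ (row b)

  record Semistandard (F : Filling N a) : Set where
    field
      nonempty        : ∀ b → Nonempty (F at b)
      columnsDistinct : ColumnsDistinct F
      rowsDecreasing  : RowsDecreasing (F at_)
      anchorsInverted : AnchorsInverted F
      freeLeast       : FreeLeast F
      firstColumn     : FirstColumnAnchored F

  wt : Filling N a → Vec ℕ N
  wt F = tabulate λ x → length (filter (λ b → x ∈? F at b) (boxes a))

  Appears : Fin N → Filling N a → Set
  Appears x F = ∃[ b ] x ∈ F at b

  Leftmost : Fin N → Filling N a → Box a → Set
  Leftmost x F b = x ∈ F at b × (∀ b′ → x ∈ F at b′ → col b ℕ.≤ col b′)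

  -- y is x^↑, the smallest label greater than x appearing in F.
  Next : Filling N a → (x y : Fin N) → Set
  Next F x y = x < y × Appears y F × (∀ z → x < z → Appears z F → y ≤ z)

  -- In a semistandard filling the box b below is determined by x.
  MesonHighest : Filling N a → Set
  MesonHighest F = ∀ x b → Leftmost x F b →
      (col b ≡ 0 × IsAnchor x (F at b))
    ⊎ (∃[ y ] Next F x y × ∃[ b′ ] y ∈ F at b′ × col b ℕ.≤ col b′ × b ≢ b′)

isMax? : (x : Fin N) (S : Subset N) → Dec (IsMax x S)
isMax? x S = x ∈? S ×-dec all? λ y → y ∈? S →-dec y ≤? x

isMin? : (x : Fin N) (S : Subset N) → Dec (IsMin x S)
isMin? x S = x ∈? S ×-dec all? λ y → y ∈? S →-dec x ≤? y

isFree? : (x : Fin N) (S : Subset N) → Dec (IsFree x S)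
isFree? x S = x ∈? S ×-dec ¬? (isMax? x S)

_≽?_ : (A B : Subset N) → Dec (A ≽ B)
A ≽? B = all? λ x → all? λ y → isMin? x A →-dec isMax? y B →-dec y ≤? x

inversion? : (α β γ : Fin N) → Dec (Inversion α β γ)
inversion? α β γ = (γ <? α ×-dec α ≤? β) ⊎-dec (α ≤? β ×-dec β <? γ)

module _ {a : Vec ℕ n} where

  adjacent? : (l r : Box a) → Dec (Adjacent l r)
  adjacent? l r = row l ≟ row r ×-dec col r ℕ.≟ suc (col l)

  triple? : (l r t : Box a) → Dec (Triple l r t)
  triple? l r t = adjacent? l r ×-dec
    (   (row r <? row t ×-dec col t ℕ.≟ col r ×-dec rowLength t ℕ.≤? rowLength r)
    ⊎-dec (row t <? row l ×-dec col t ℕ.≟ col l ×-dec rowLength t ℕ.<? rowLength l))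

  rowsDecreasing? : (T : Box a → Subset N) → Dec (RowsDecreasing T)
  rowsDecreasing? T = allBox? λ l → allBox? λ r → adjacent? l r →-dec T l ≽? T r

  columnsDistinct? : (F : Filling N a) → Dec (ColumnsDistinct F)
  columnsDistinct? F = allBox? λ b → allBox? λ b′ → all? λ x →
    col b ℕ.≟ col b′ →-dec x ∈? F at b →-dec x ∈? F at b′ →-dec b ≟ᵇ b′

  anchorsInverted? : (F : Filling N a) → Dec (AnchorsInverted F)
  anchorsInverted? F = allBox? λ l → allBox? λ r → allBox? λ t → triple? l r t →-dec
    all? λ α → all? λ β → all? λ γ →
      isMax? α (F at r) →-dec isMax? β (F at l) →-dec isMax? γ (F at t) →-dec
      inversion? α β γ

  freeLeast? : (F : Filling N a) → Dec (FreeLeast F)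
  freeLeast? F = allBox? λ b → allBox? λ b′ → col b ℕ.≟ col b′ →-dec
    all? λ x → all? λ m → all? λ m′ →
      isFree? x (F at b) →-dec isMax? m (F at b) →-dec isMax? m′ (F at b′) →-dec
      x <? m′ →-dec m′ <? m →-dec ¬? (rowsDecreasing? (insert (F at_) b′ x))

  firstColumn? : (F : Filling N a) → Dec (FirstColumnAnchored F)
  firstColumn? F = allBox? λ b → col b ℕ.≟ 0 →-dec
    all? λ x → isMax? x (F at b) →-dec toℕ x ℕ.≟ toℕ (row b)

  nonempty?ᶠ : (F : Filling N a) → Dec (∀ b → Nonempty (F at b))
  nonempty?ᶠ F = allBox? λ b → nonempty? (F at b)

  semistandard? : (F : Filling N a) → Dec (Semistandard F)
  semistandard? F = map′
    (λ (p , q , r , s , t , u) → record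
      { nonempty = p ; columnsDistinct = q ; rowsDecreasing = r
      ; anchorsInverted = s ; freeLeast = t ; firstColumn = u })
    (λ S → let open Semistandard S in
      nonempty , columnsDistinct , rowsDecreasing , anchorsInverted , freeLeast , firstColumn)
    (nonempty?ᶠ F ×-dec columnsDistinct? F ×-dec rowsDecreasing? (F at_) ×-dec
     anchorsInverted? F ×-dec freeLeast? F ×-dec firstColumn? F)

  appears? : (x : Fin N) (F : Filling N a) → Dec (Appears x F)
  appears? x F = anyBox? λ b → x ∈? F at b

  leftmost? : (x : Fin N) (F : Filling N a) (b : Box a) → Dec (Leftmost x F b)
  leftmost? x F b = x ∈? F at b ×-dec
    allBox? λ b′ → x ∈? F at b′ →-dec col b ℕ.≤? col b′

  next? : (F : Filling N a) (x y : Fin N) → Dec (Next F x y)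
  next? F x y = x <? y ×-dec appears? y F ×-dec
    all? λ z → x <? z →-dec appears? z F →-dec y ≤? z

  mesonHighest? : (F : Filling N a) → Dec (MesonHighest F)
  mesonHighest? F = all? λ x → allBox? λ b → leftmost? x F b →-dec
    (   (col b ℕ.≟ 0 ×-dec isMax? x (F at b))
    ⊎-dec any? λ y → next? F x y ×-dec
            anyBox? λ b′ → y ∈? F at b′ ×-dec col b ℕ.≤? col b′ ×-dec ¬? (b ≟ᵇ b′))

------------------------------------------------------------------------
-- Lascoux atoms

vecs : List A → ∀ n → List (Vec A n)
vecs xs zero    = [ [] ]
vecs xs (suc n) = cartesianProductWith _∷_ xs (vecs xs n)

subsets : ∀ N → List (Subset N)
subsets = vecs (outside ∷ inside ∷ [])

fillings : ∀ N (a : Vec ℕ n) → List (Filling N a)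
fillings N []      = [ [] ]
fillings N (k ∷ a) = cartesianProductWith _∷_ (vecs (subsets N) k) (fillings N a)

-- The semistandard fillings of D(a), without repetition: see SSF-sound,
-- SSF-complete and SSF-unique.  Allowing entries beyond n would add
-- none: see entry≤row.
SSF : (a : Vec ℕ n) → List (Filling n a)
SSF a = filter semistandard? (fillings _ a)

A2P : (a : Vec ℕ n) → List (Filling n a)
A2P a = filter mesonHighest? (SSF a)

-- The number of free entries; the subtraction does not truncate when
-- every box is nonempty.
exᶠ : {a : Vec ℕ n} → Filling n a → ℕ
exᶠ {a = a} F = ∣ wt F ∣ ∸ ∣ a ∣

lascouxAtom : Vec ℕ n → Poly n
lascouxAtom a = ∑[ F ← SSF a ] (β^ exᶠ F ⊗ 𝐱^ wt F)

------------------------------------------------------------------------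
-- Kaons

data Color : Set where
  black red : Color

-- part c k is the positive entry k + 1 with color c.
data Entry : Set where
  nil  : Entry
  part : Color → ℕ → Entry

size : Entry → ℕ
size nil        = 0
size (part _ k) = suc k

redness : Entry → ℕ
redness nil            = 0
redness (part black _) = 0
redness (part red   _) = 1

Komposition : ℕ → Set
Komposition n = Vec Entry n

underlying : Komposition n → Vec ℕ n
underlying = Vec.map size

ex : Komposition n → ℕ
ex b = Vec.sum (Vec.map redness b)

-- When p = n_j is a position of a nonzero entry of a, the positions k
-- with n_{j-1} < k ≤ n_j.
InBlock : Vec ℕ n → (p k : Fin n) → Set
InBlock a p k = k ≤ p × (∀ q → q < p → lookup a q ≢ 0 → q < k)

inBlock? : (a : Vec ℕ n) (p k : Fin n) → Dec (InBlock a p k)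
inBlock? a p k = k ≤? p ×-dec
  all? λ q → q <? p →-dec ¬? (lookup a q ℕ.≟ 0) →-dec q <? k

block : Vec ℕ n → Fin n → List (Fin n)
block a p = filter (inBlock? a p) (allFin _)

sumOver : List (Fin n) → (Entry → ℕ) → Komposition n → ℕ
sumOver ks f b = sum (List.map (f ∘ lookup b) ks)

record MesonicGlide (a : Vec ℕ n) (b : Komposition n) : Set where
  field
    vanishing : ∀ k → (∀ p → lookup a p ≢ 0 → p < k) → lookup b k ≡ nil
    -- a_p = (sum of the block) − ex(block), with the excess moved to the
    -- other side.
    total     : ∀ p → lookup a p ≢ 0 →
                lookup a p + sumOver (block a p) redness b ≡ sumOver (block a p) size b
    leading   : ∀ p → lookup a p ≢ 0 → ∀ k → InBlock a p k → lookup b k ≢ nil →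
                (∀ q → InBlock a p q → q < k → lookup b q ≡ nil) →
                ∃[ m ] lookup b k ≡ part black m
    end       : ∀ p → lookup a p ≢ 0 → lookup b p ≢ nil

nil? : ∀ e → Dec (e ≡ nil)
nil? nil        = yes refl
nil? (part _ _) = no λ ()

black? : ∀ e → Dec (∃[ m ] e ≡ part black m)
black? nil            = no λ ()
black? (part black m) = yes (m , refl)
black? (part red   m) = no λ ()

mesonicGlide? : (a : Vec ℕ n) (b : Komposition n) → Dec (MesonicGlide a b)
mesonicGlide? a b = map′
  (λ (v , t , l , e) → record { vanishing = v ; total = t ; leading = l ; end = e })
  (λ G → let open MesonicGlide G in vanishing , total , leading , end)
  (   (all? λ k → (all? λ p → nz? p →-dec p <? k) →-dec nil? (lookup b k))
  ×-dec (all? λ p → nz? p →-dec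
          lookup a p + sumOver (block a p) redness b ℕ.≟ sumOver (block a p) size b)
  ×-dec (all? λ p → nz? p →-dec all? λ k → inBlock? a p k →-dec ¬? (nil? (lookup b k)) →-dec
          (all? λ q → inBlock? a p q →-dec q <? k →-dec nil? (lookup b q)) →-dec
          black? (lookup b k))
  ×-dec (all? λ p → nz? p →-dec ¬? (nil? (lookup b p))))
  where
  nz? : ∀ p → Dec (lookup a p ≢ 0)
  nz? p = ¬? (lookup a p ℕ.≟ 0)

entriesUpTo : ℕ → List Entry
entriesUpTo m = nil ∷ cartesianProductWith part (black ∷ red ∷ []) (upTo m)

-- All mesonic glides of a, without repetition: see
-- mesonicGlides-sound, -complete and -unique.
mesonicGlides : (a : Vec ℕ n) → List (Komposition n)
mesonicGlides {n} a = filter (mesonicGlide? a) (vecs (entriesUpTo (suc ∣ a ∣)) n)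

kaon : Vec ℕ n → Poly n
kaon a = ∑[ b ← mesonicGlides a ] (β^ ex b ⊗ 𝐱^ underlying b)

------------------------------------------------------------------------
-- The lists summed over are complete and have no repetitions

∈-vecs : (xs : List A) (v : Vec A n) → (∀ i → lookup v i L.∈ xs) → v L.∈ vecs xs n
∈-vecs xs []      h = here refl
∈-vecs xs (x ∷ v) h =
  ∈-cartesianProductWith⁺ _∷_ (h zero) (∈-vecs xs v (h ∘ suc))

vecs-unique : {xs : List A} → Unique xs → ∀ n → Unique (vecs xs n)
vecs-unique u zero    = LAll.[] AllPairs.∷ AllPairs.[]
vecs-unique u (suc n) =
  Unique.cartesianProductWith⁺ _∷_ Vec.∷-injective u (vecs-unique u n)

∈-subsets : (S : Subset N) → S L.∈ subsets N
∈-subsets S = ∈-vecs _ S λ i → bool (lookup S i)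
  where
  bool : (b : Bool) → b L.∈ (outside ∷ inside ∷ [])
  bool false = here refl
  bool true  = there (here refl)

subsets-unique : ∀ N → Unique (subsets N)
subsets-unique = vecs-unique
  (((λ ()) LAll.∷ LAll.[]) AllPairs.∷ (LAll.[] AllPairs.∷ AllPairs.[]))

∈-fillings : {a : Vec ℕ n} (F : Filling N a) → F L.∈ fillings N a
∈-fillings []      = here refl
∈-fillings (r ∷ F) = ∈-cartesianProductWith⁺ _∷_
  (∈-vecs _ r λ i → ∈-subsets (lookup r i)) (∈-fillings F)

fillings-unique : ∀ N (a : Vec ℕ n) → Unique (fillings N a)
fillings-unique N []      = LAll.[] AllPairs.∷ AllPairs.[]
fillings-unique N (k ∷ a) = Unique.cartesianProductWith⁺ _∷_
  (λ { refl → refl , refl })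
  (vecs-unique (subsets-unique N) k) (fillings-unique N a)

SSF-sound : {a : Vec ℕ n} (F : Filling n a) → F L.∈ SSF a → Semistandard F
SSF-sound {n} {a} F F∈ =
  proj₂ (∈-filter⁻ (semistandard? {n} {a}) {xs = fillings n a} F∈)

SSF-complete : {a : Vec ℕ n} (F : Filling n a) → Semistandard F → F L.∈ SSF a
SSF-complete {n} {a} F S =
  ∈-filter⁺ (semistandard? {n} {a}) {x = F} {xs = fillings n a} (∈-fillings F) S

SSF-unique : (a : Vec ℕ n) → Unique (SSF a)
SSF-unique {n} a =
  Unique.filter⁺ (semistandard? {n} {a}) {xs = fillings n a} (fillings-unique n a)

A2P-sound : {a : Vec ℕ n} (F : Filling n a) → F L.∈ A2P a → Semistandard F × MesonHighest F
A2P-sound {n} {a} F F∈ =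
  let F∈SSF , M = ∈-filter⁻ (mesonHighest? {n} {a}) {xs = SSF a} F∈ in SSF-sound F F∈SSF , M

A2P-complete : {a : Vec ℕ n} (F : Filling n a) → Semistandard F → MesonHighest F → F L.∈ A2P a
A2P-complete {n} {a} F S M =
  ∈-filter⁺ (mesonHighest? {n} {a}) {x = F} {xs = SSF a} (SSF-complete F S) M

A2P-unique : (a : Vec ℕ n) → Unique (A2P a)
A2P-unique {n} a = Unique.filter⁺ (mesonHighest? {n} {a}) {xs = SSF a} (SSF-unique a)

max-exists : {S : Subset N} → Nonempty S → ∃[ x ] IsMax x S
max-exists {suc N} {s ∷ S} (x , x∈) with nonempty? S
... | yes ne = let (m , m∈ , max) = max-exists ne in
  suc m , Vec.there m∈ , λ { zero _ → z≤n ; (suc y) y∈ → s≤s (max y (drop-there y∈)) }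
max-exists {suc N} {s ∷ S} (zero  , x∈) | no e =
  zero , x∈ , λ { zero _ → z≤n ; (suc y) y∈ → contradiction (y , drop-there y∈) e }
max-exists {suc N} {s ∷ S} (suc x , x∈) | no e = contradiction (x , drop-there x∈) e

min-exists : {S : Subset N} → Nonempty S → ∃[ x ] IsMin x S
min-exists {suc N} {inside  ∷ S} _           = zero , Vec.here , λ _ _ → z≤n
min-exists {suc N} {outside ∷ S} (suc x , x∈) =
  let (m , m∈ , min) = min-exists (x , drop-there x∈) in
  suc m , Vec.there m∈ , λ { (suc y) y∈ → s≤s (min y (drop-there y∈)) }

-- Whatever range of positive integers is allowed, every entry is at
-- most the index of its row, hence at most n.
entry≤row : {a : Vec ℕ n} {F : Filling N a} → Semistandard F →
            ∀ b x → x ∈ F at b → toℕ x ℕ.≤ toℕ (row b)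
entry≤row {a = a} {F} S ⟨ i , j ⟩ = go j (toℕ j) refl
  where
  open Semistandard S
  left : ∀ {k} (j : Fin k) m → toℕ j ≡ suc m → Σ[ j′ ∈ Fin k ] toℕ j′ ≡ m
  left (suc j) m e = inject₁ j , trans (Fin.toℕ-inject₁ j) (ℕ.suc-injective e)

  go : ∀ j m → toℕ j ≡ m → ∀ x → x ∈ F at ⟨ i , j ⟩ → toℕ x ℕ.≤ toℕ i
  go j m e x x∈ with max-exists (x , x∈)
  go j zero e x x∈    | y , Y =
    ℕ.≤-trans (proj₂ Y x x∈) (ℕ.≤-reflexive (firstColumn ⟨ i , j ⟩ e y Y))
  go j (suc m) e x x∈ | y , Y with left j m e
  ... | j′ , e′ with min-exists (nonempty ⟨ i , j′ ⟩)
  ... | z , Z = ℕ.≤-trans (proj₂ Y x x∈) (ℕ.≤-trans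
    (rowsDecreasing ⟨ i , j′ ⟩ ⟨ i , j ⟩ (refl , trans e (cong suc (sym e′))) z y Z Y)
    (go j′ m e′ z (proj₁ Z)))

private
  least : {P : Fin n → Set} → (∀ p → Dec (P p)) → ∃ P →
          ∃[ p ] P p × (∀ q → q < p → ¬ P q)
  least {suc n} P? (p , Pp) with P? zero
  ... | yes P0 = zero , P0 , λ _ ()
  least {suc n} P? (zero  , Pp) | no ¬P0 = contradiction Pp ¬P0
  least {suc n} P? (suc p , Pp) | no ¬P0 with least (P? ∘ suc) (p , Pp)
  ... | q , Pq , min = suc q , Pq , λ { zero _ → ¬P0 ; (suc r) (s≤s r<q) → min r r<q }

  redness≤size : ∀ e → redness e ℕ.≤ size e
  redness≤size nil            = z≤n
  redness≤size (part black _) = z≤n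
  redness≤size (part red   _) = s≤s z≤n

  redness≤1 : ∀ e → redness e ℕ.≤ 1
  redness≤1 nil            = z≤n
  redness≤1 (part black _) = z≤n
  redness≤1 (part red   _) = s≤s z≤n

  sums : (b : Komposition n) (ks : List (Fin n)) →
         sumOver ks redness b ℕ.≤ sumOver ks size b
  sums b []       = z≤n
  sums b (k ∷ ks) = ℕ.+-mono-≤ (redness≤size (lookup b k)) (sums b ks)

  size≤ : (b : Komposition n) {k : Fin n} {ks : List (Fin n)} → k L.∈ ks →
          size (lookup b k) + sumOver ks redness b ℕ.≤ suc (sumOver ks size b)
  size≤ b {k} {k ∷ ks} (here refl) = begin
    s + (r + R)  ≡⟨ ℕ.+-comm s (r + R) ⟩
    r + R + s    ≤⟨ ℕ.+-monoˡ-≤ s (ℕ.+-mono-≤ (redness≤1 (lookup b k)) (sums b ks)) ⟩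
    suc (S + s)  ≡⟨ cong suc (ℕ.+-comm S s) ⟩
    suc (s + S)  ∎
    where
    open ℕ.≤-Reasoning
    s = size (lookup b k)
    r = redness (lookup b k)
    R = sumOver ks redness b
    S = sumOver ks size b
  size≤ b {k} {l ∷ ks} (there k∈) = begin
    s + (r + R)  ≡⟨ sym (ℕ.+-assoc s r R) ⟩
    s + r + R    ≡⟨ cong (_+ R) (ℕ.+-comm s r) ⟩
    r + s + R    ≡⟨ ℕ.+-assoc r s R ⟩
    r + (s + R)  ≤⟨ ℕ.+-mono-≤ (redness≤size (lookup b l)) (size≤ b k∈) ⟩
    t + suc S    ≡⟨ ℕ.+-suc t S ⟩
    suc (t + S)  ∎
    where
    open ℕ.≤-Reasoning
    s = size (lookup b k)
    t = size (lookup b l)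
    r = redness (lookup b l)
    R = sumOver ks redness b
    S = sumOver ks size b

  lookup≤sum : (a : Vec ℕ n) (p : Fin n) → lookup a p ℕ.≤ ∣ a ∣
  lookup≤sum (x ∷ a) zero    = ℕ.m≤m+n x _
  lookup≤sum (x ∷ a) (suc p) = ℕ.≤-trans (lookup≤sum a p) (ℕ.m≤n+m _ x)

  ∈-entriesUpTo : ∀ {m} e → size e ℕ.≤ m → e L.∈ entriesUpTo m
  ∈-entriesUpTo nil            _   = here refl
  ∈-entriesUpTo (part c k)     k<m =
    there (∈-cartesianProductWith⁺ part (color c) (∈-upTo⁺ k<m))
    where
    color : ∀ c → c L.∈ (black ∷ red ∷ [])
    color black = here refl
    color red   = there (here refl)

glide-bounded : {a : Vec ℕ n} {b : Komposition n} → MesonicGlide a b →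
                ∀ k → size (lookup b k) ℕ.≤ suc ∣ a ∣
glide-bounded {n} {a} {b} G k with any? (λ p → k ≤? p ×-dec ¬? (lookup a p ℕ.≟ 0))
... | no ∄p = subst (λ e → size e ℕ.≤ suc ∣ a ∣)
  (sym (vanishing k λ p p≢0 → ℕ.≰⇒> λ k≤p → ∄p (p , k≤p , p≢0))) z≤n
  where open MesonicGlide G
... | yes e with least (λ p → k ≤? p ×-dec ¬? (lookup a p ℕ.≟ 0)) e
... | p , (k≤p , p≢0) , min = ℕ.+-cancelʳ-≤ R _ _ (begin
    size (lookup b k) + R      ≤⟨ size≤ b k∈ ⟩
    suc (sumOver ks size b)    ≡⟨ cong suc (sym (total p p≢0)) ⟩
    suc (lookup a p + R)       ≤⟨ s≤s (ℕ.+-monoˡ-≤ R (lookup≤sum a p)) ⟩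
    suc (∣ a ∣ + R)            ∎)
  where
  open MesonicGlide G
  open ℕ.≤-Reasoning
  ks = block a p
  R  = sumOver ks redness b
  k∈ : k L.∈ ks
  k∈ = ∈-filter⁺ (inBlock? a p) (∈-allFin k)
    (k≤p , λ q q<p q≢0 → ℕ.≰⇒> λ k≤q → min q q<p (k≤q , q≢0))

mesonicGlides-sound : (a : Vec ℕ n) (b : Komposition n) → b L.∈ mesonicGlides a → MesonicGlide a b
mesonicGlides-sound {n} a b b∈ =
  proj₂ (∈-filter⁻ (mesonicGlide? a) {xs = vecs (entriesUpTo (suc ∣ a ∣)) n} b∈)

mesonicGlides-complete : (a : Vec ℕ n) (b : Komposition n) → MesonicGlide a b → b L.∈ mesonicGlides a
mesonicGlides-complete {n} a b G =
  ∈-filter⁺ (mesonicGlide? a) {x = b} {xs = vecs (entriesUpTo (suc ∣ a ∣)) n}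
    (∈-vecs _ b λ k → ∈-entriesUpTo (lookup b k) (glide-bounded G k)) G

mesonicGlides-unique : (a : Vec ℕ n) → Unique (mesonicGlides a)
mesonicGlides-unique {n} a =
  Unique.filter⁺ (mesonicGlide? a) {xs = vecs (entriesUpTo (suc ∣ a ∣)) n}
    (vecs-unique (entries-unique {suc ∣ a ∣}) n)
  where
  entries-unique : ∀ {m} → Unique (entriesUpTo m)
  entries-unique {m} = LAll.tabulate nil∉ AllPairs.∷
    Unique.cartesianProductWith⁺ part (λ { refl → refl , refl })
      (((λ ()) LAll.∷ LAll.[]) AllPairs.∷ (LAll.[] AllPairs.∷ AllPairs.[])) (Unique.upTo⁺ m)
    where
    open import Data.List.Membership.Propositional.Properties using (∈-cartesianProductWith⁻)
    nil∉ : ∀ {e} → e L.∈ cartesianProductWith part (black ∷ red ∷ []) (upTo m) → nil ≢ e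
    nil∉ e∈ refl with ∈-cartesianProductWith⁻ part (black ∷ red ∷ []) (upTo m) e∈
    ... | ()

{-# OPTIONS --safe #-}

-- Encode a filling F by the lists L_x of the boxes containing the label x,
-- read from left to right.  Raise x to x^↑ whenever every box of L_{x^↑} lies
-- strictly left of, or equals, every box of L_x: this concatenates L_{x^↑}
-- and L_x, the two overlapping in at most one box.  Each block of labels
-- merged into one label z is recorded by a cutting of the resulting list into
-- consecutive pieces, that is by a mesonic glide, a piece being red when it
-- shares its last box with the next piece.  The maximally raised filling T is
-- the one in which no two consecutive labels can be merged, which for
-- semistandard fillings means meson-highest, and raising preserves and
-- reflects semistandardness.  So F ↦ (T , b) is a weight-preserving bijection.
module Submission where

open import Defs
import Algebra.Properties.CommutativeSemigroup as CommutativeSemigroup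
open import Data.Bool using (true; false; if_then_else_)
open import Data.Empty using (⊥-elim)
open import Data.Fin using (Fin; zero; suc; toℕ; _<_; _≤_; _<?_)
open import Data.Fin.Properties
  using (≤-refl; ≤-antisym; ≤∧≢⇒<; <-cmp; <-trans; <-irrefl; toℕ-injective; any?)
open import Data.Fin.Subset as Subset using (Subset; ⁅_⁆; _∪_; Nonempty)
open import Data.Fin.Subset.Properties using (_∈?_; x∈⁅x⁆; x∈⁅y⁆⇒x≡y; x∈p∪q⁻; x∈p∪q⁺; ⊆-antisym)
open import Data.Integer as ℤ using (ℤ; 1ℤ)
import Data.Integer.Properties as ℤ
open import Data.List as List
  using (List; []; _∷_; [_]; _++_; _∷ʳ_; length; filter; concatMap; allFin; initLast; _∷ʳ′_)
import Data.List.Membership.DecPropositional as DecMembership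
open import Data.List.Membership.Propositional using (_∈_)
open import Data.List.Membership.Propositional.Properties
  using (∈-∃++; ∈-++⁺ˡ; ∈-++⁺ʳ; ∈-++⁻; ∈-filter⁺; ∈-filter⁻; ∈-map⁺; ∈-map⁻; ∈-allFin; ∈-concat⁺′)
import Data.List.Properties as List
open import Data.List.Relation.Binary.Permutation.Propositional as ↭
  using (_↭_; prep; swap; ↭-sym; ↭-trans; ↭-refl; ↭⇒↭ₛ)
import Data.List.Relation.Binary.Permutation.Propositional.Properties as ↭
import Data.List.Relation.Binary.Permutation.Setoid.Properties as ↭ₛ
open import Data.List.Relation.Binary.Subset.Propositional using (_⊆_)
open import Data.List.Relation.Unary.All as LAll using ([]; _∷_)
import Data.List.Relation.Unary.All.Properties as LAll
open import Data.List.Relation.Unary.AllPairs as AllPairs using (AllPairs; []; _∷_)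
import Data.List.Relation.Unary.AllPairs.Properties as AllPairs
open import Data.List.Relation.Unary.Any using (here; there)
import Data.List.Relation.Unary.Sorted.TotalOrder.Properties as Sorted
open import Data.List.Relation.Unary.Unique.Propositional using (Unique)
import Data.List.Relation.Unary.Unique.Propositional.Properties as Unique
import Data.List.Sort as Sort
open import Data.Nat as ℕ using (ℕ; zero; suc; _+_; _∸_; NonZero; z≤n; s≤s; s≤s⁻¹)
import Data.Nat.Properties as ℕ
open import Data.Product using (Σ-syntax; ∃; ∃-syntax; ∃₂; _×_; _,_; proj₁; proj₂)
open import Data.Sum using (_⊎_; inj₁; inj₂)
open import Data.Unit using (⊤; tt)
open import Data.Vec as Vec using (Vec; []; _∷_; lookup; tabulate)
import Data.Vec.Properties as Vec
open import Data.Vec.Relation.Unary.All using (All; []; _∷_)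
open import Data.Vec.Relation.Unary.All.Properties using (lookup⁺; lookup⁻)
open import Function using (_∘_)
open import Relation.Binary using (DecidableEquality; tri<; tri≈; tri>)
import Relation.Binary.Construct.On as On
open import Relation.Binary.PropositionalEquality hiding ([_])
open import Relation.Nullary using (¬_; Dec; yes; no; does; contradiction)
open import Relation.Nullary.Decidable using (map′; ¬?; _×-dec_; _⊎-dec_; dec-true; dec-false)

open Box using (row; col)
open CommutativeSemigroup ℕ.+-commutativeSemigroup using (interchange; x∙yz≈y∙xz; xy∙z≈xz∙y)

-- Raising may turn a strict inequality between two labels of one block into an equality, which
-- could spoil (S.1) or an inversion triple, and undoing it could create new violations. Both
-- dangers disappear for one reason: in a block the larger label shares its box with the smaller one
-- or stands in an earlier column, and no strict comparison that matters has its entries placed in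
-- this way. So everything about blocks can be done on vectors of ascending lists, with no skyline
-- diagram in sight.
--
-- There, a single scan over the labels with a carry serves for gluing and for cutting. It is a
-- relation between fine vector, glide and coarse vector because it is run from both ends: from `F`
-- greedily upward through the labels, from `(T , b)` downward from the largest label. Uniqueness of
-- `T` is the delicate point: if one scan stopped where another went on, the one that stopped would
-- contain two consecutive lists that can still be merged. All terms have coefficient 1, so the
-- polynomial identity needs no cancellation, only a permutation of terms.

private
  variable
    n N : ℕ
    A A′ B : Set

-- JoinLength and Glide record the lengths of the lists in Join and
-- Coarsens below.
data JoinLength : Entry → ℕ → ℕ → Set where
  none  : ∀ {c} → JoinLength nil c c
  black : ∀ {k c} → JoinLength (part black k) c (suc k + c)
  red   : ∀ {k c} → JoinLength (part red k) (suc c) (k + suc c)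

data Glide : ∀ {n} → ℕ → Komposition n → Vec ℕ n → Set where
  done : Glide 0 [] []
  hold : ∀ {e c d} {b : Komposition n} {w} →
         JoinLength e c d → Glide d b w → Glide c (e ∷ b) (0 ∷ w)
  emit : ∀ {e c d} {b : Komposition n} {w} →
         JoinLength e c d → e ≢ nil → Glide 0 b w → Glide c (e ∷ b) (d ∷ w)

-- First nonempty lists and the label to which a label is raised

module _ {A : Set} where

  data First : ∀ {n} → List A → Vec (List A) n → Set where
    here  : ∀ {t} {T : Vec (List A) n} → t ≢ [] → First t (t ∷ T)
    there : ∀ {t} {T : Vec (List A) n} → First t T → First t ([] ∷ T)

  first-unique : ∀ {s t} {T : Vec (List A) n} → First s T → First t T → s ≡ t
  first-unique (here _)   (here _)   = refl
  first-unique (here ne)  (there _)  = contradiction refl ne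
  first-unique (there _)  (here ne)  = contradiction refl ne
  first-unique (there s)  (there t)  = first-unique s t

  first? : (T : Vec (List A) n) → Dec (∃[ t ] First t T)
  first? []             = no λ ()
  first? ([] ∷ T)       = map′ (λ (t , f) → t , there f)
    (λ { (_ , here ne) → contradiction refl ne ; (t , there f) → t , f }) (first? T)
  first? ((x ∷ t) ∷ T)  = yes (_ , here λ ())

  -- Top T x z: z is the least index of a nonempty list with x ≤ z.
  data FirstAt : ∀ {n} → Vec (List A) n → Fin n → Set where
    here  : ∀ {t} {T : Vec (List A) n} → t ≢ [] → FirstAt (t ∷ T) zero
    there : ∀ {z} {T : Vec (List A) n} → FirstAt T z → FirstAt ([] ∷ T) (suc z)

  data Top : ∀ {n} → Vec (List A) n → Fin n → Fin n → Set where
    start : ∀ {z} {T : Vec (List A) (suc n)} → FirstAt T z → Top T zero z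
    step  : ∀ {t x z} {T : Vec (List A) n} → Top T x z → Top (t ∷ T) (suc x) (suc z)

  firstAt⇒≢[] : ∀ {T : Vec (List A) n} {z} → FirstAt T z → lookup T z ≢ []
  firstAt⇒≢[] (here ne) = ne
  firstAt⇒≢[] (there f) = firstAt⇒≢[] f

  top⇒≢[] : ∀ {T : Vec (List A) n} {x z} → Top T x z → lookup T z ≢ []
  top⇒≢[] (start f) = firstAt⇒≢[] f
  top⇒≢[] (step t)  = top⇒≢[] t

  firstAt-least : ∀ {T : Vec (List A) n} {z w} → FirstAt T z → lookup T w ≢ [] → z ≤ w
  firstAt-least (here _)          _  = z≤n
  firstAt-least {w = zero}  (there f) ne = contradiction refl ne
  firstAt-least {w = suc w} (there f) ne = s≤s (firstAt-least f ne)

  x≤top : ∀ {T : Vec (List A) n} {x z} → Top T x z → x ≤ z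
  x≤top (start _) = z≤n
  x≤top (step t)  = s≤s (x≤top t)

  firstAt⇒top : ∀ {T : Vec (List A) n} {z} → FirstAt T z → Top T z z
  firstAt⇒top f@(here _) = start f
  firstAt⇒top (there f)  = step (firstAt⇒top f)

  top-idem : ∀ {T : Vec (List A) n} {x z} → Top T x z → Top T z z
  top-idem (start f) = firstAt⇒top f
  top-idem (step t)  = step (top-idem t)

  top-least : ∀ {T : Vec (List A) n} {x z w} → Top T x z → lookup T w ≢ [] → x ≤ w → z ≤ w
  top-least (start f) ne _ = firstAt-least f ne
  top-least {w = suc w} (step t) ne (s≤s x≤w) = s≤s (top-least t ne x≤w)

  top-mono : ∀ {T : Vec (List A) n} {x y z w} → Top T x z → Top T y w → x ≤ y → z ≤ w
  top-mono t u x≤y = top-least t (top⇒≢[] u) (ℕ.≤-trans x≤y (x≤top u))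

-- Joining and cutting ascending lists of boxes

module Splitting {B : Set} (col : B → ℕ) (_≟_ : DecidableEquality B) where

  Ascending : List B → Set
  Ascending = AllPairs λ x y → col x ℕ.< col y

  infix 4 _≼_ _⊲_
  _≼_ : B → B → Set
  x ≼ y = x ≡ y ⊎ col x ℕ.< col y

  ≼-trans : ∀ {x y z} → x ≼ y → y ≼ z → x ≼ z
  ≼-trans (inj₁ refl) q           = q
  ≼-trans (inj₂ p)    (inj₁ refl) = inj₂ p
  ≼-trans (inj₂ p)    (inj₂ q)    = inj₂ (ℕ.<-trans p q)

  _≼?_ : ∀ x y → Dec (x ≼ y)
  x ≼? y = (x ≟ y) ⊎-dec (col x ℕ.<? col y)

  -- For ascending nonempty lists this says that `l` followed by `C` is ascending once a common box
  -- at the seam is counted only once.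
  _⊲_ : List B → List B → Set
  l ⊲ C = ∀ {x y} → x ∈ l → y ∈ C → x ≼ y

  _⊲?_ : ∀ l C → Dec (l ⊲ C)
  l ⊲? C = map′ (λ h x∈ y∈ → LAll.lookup (LAll.lookup h x∈) y∈)
                (λ h → LAll.tabulate λ x∈ → LAll.tabulate (h x∈))
                (LAll.all? (λ x → LAll.all? (x ≼?_) C) l)

  -- A box of `C` is the link between the two relations; over an empty `C` both hold vacuously.
  ⊲-trans : ∀ {l C D} → C ≢ [] → l ⊲ C → C ⊲ D → l ⊲ D
  ⊲-trans {C = []}    ne _ _ = contradiction refl ne
  ⊲-trans {C = c ∷ C} _  p q x∈ y∈ = ≼-trans (p x∈ (here refl)) (q (here refl) y∈)

  asc-++⁻ : ∀ l {C} → Ascending (l ++ C) →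
            Ascending l × Ascending C × (∀ {x y} → x ∈ l → y ∈ C → col x ℕ.< col y)
  asc-++⁻ []      a       = [] , a , λ ()
  asc-++⁻ (x ∷ l) (h ∷ a) = let (p , q , r) = asc-++⁻ l a in
    LAll.++⁻ˡ l h ∷ p , q ,
    λ { (here refl) y∈ → LAll.lookup (LAll.++⁻ʳ l h) y∈ ; (there x∈) y∈ → r x∈ y∈ }

  asc-++⁺ : ∀ {l C} → Ascending l → Ascending C →
            (∀ {x y} → x ∈ l → y ∈ C → col x ℕ.< col y) → Ascending (l ++ C)
  asc-++⁺ a b h = AllPairs.++⁺ a b (LAll.tabulate λ x∈ → LAll.tabulate (h x∈))

  -- If the heads differed, each would lie in the tail of the other list, hence strictly right of
  -- the other.
  asc-ext : ∀ {l C} → Ascending l → Ascending C → l ⊆ C → C ⊆ l → l ≡ C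
  asc-ext {[]}    {[]}    _ _ _ _ = refl
  asc-ext {[]}    {_ ∷ _} _ _ _ q with () ← q (here refl)
  asc-ext {_ ∷ _} {[]}    _ _ p _ with () ← p (here refl)
  asc-ext {x ∷ l} {y ∷ C} (h ∷ a) (k ∷ b) p q = cong₂ _∷_ (head (p (here refl)) (q (here refl)))
    (asc-ext a b (λ z∈ → tail h (head (p (here refl)) (q (here refl))) z∈ (p (there z∈)))
      (λ z∈ → tail k (sym (head (p (here refl)) (q (here refl)))) z∈ (q (there z∈))))
    where
    head : x ∈ y ∷ C → y ∈ x ∷ l → x ≡ y
    head (here e)   _          = e
    head (there _)  (here e)   = sym e
    head (there x∈) (there y∈) =
      contradiction (LAll.lookup h y∈) (ℕ.<-asym (LAll.lookup k x∈))
    tail : ∀ {x y z : B} {l C} → LAll.All (λ y → col x ℕ.< col y) l → x ≡ y → z ∈ l → z ∈ y ∷ C → z ∈ C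
    tail h refl z∈ (here refl) = contradiction (LAll.lookup h z∈) (ℕ.<-irrefl refl)
    tail h _    z∈ (there z∈′) = z∈′

  -- D is l followed by C; a red entry says that the last box of l is the
  -- first box of C, and so occurs only once in D.
  data Join : List B → Entry → List B → List B → Set where
    none  : ∀ {C} → Join [] nil C C
    black : ∀ {x l C} → Join (x ∷ l) (part black (length l)) C (x ∷ l ++ C)
    red   : ∀ {l m c C} → l ≡ m ∷ʳ c → Join l (part red (length m)) (c ∷ C) (m ++ c ∷ C)

  private
    variable
      l C D : List B
      e : Entry

  []≢∷ʳ : ∀ (m : List B) {c} → [] ≢ m ∷ʳ c
  []≢∷ʳ []      ()
  []≢∷ʳ (_ ∷ _) ()

  join-size : Join l e C D → length l ≡ size e
  join-size none  = refl
  join-size black = refl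
  join-size (red {m = m} refl) = trans (List.length-++ m) (ℕ.+-comm (length m) 1)

  join-weight : Join l e C D → length l + length C ≡ length D + redness e
  join-weight {C = C} none  = sym (ℕ.+-identityʳ _)
  join-weight {C = C} (black {l = l}) =
    sym (trans (ℕ.+-identityʳ _) (cong suc (List.length-++ l)))
  join-weight (red {m = m} {c} {C} refl)
    rewrite List.length-++ m {[ c ]} | List.length-++ m {c ∷ C} =
      xy∙z≈xz∙y (length m) 1 (suc (length C))

  join-length : Join l e C D → JoinLength e (length C) (length D)
  join-length none  = none
  join-length {C = C} (black {l = l}) rewrite List.length-++ l {C} = black
  join-length (red {m = m} {c} {C} _) rewrite List.length-++ m {c ∷ C} = red

  join-nil : Join l e C D → e ≢ nil → l ≢ []
  join-nil none  ne = contradiction refl ne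
  join-nil black _  = λ ()
  join-nil (red {m = m} refl) _ = []≢∷ʳ m ∘ sym

  join-≢nil : Join l e C D → l ≢ [] → e ≢ nil
  join-≢nil none ne _ = ne refl

  join-∈⁻ : Join l e C D → ∀ {x} → x ∈ D → x ∈ l ⊎ x ∈ C
  join-∈⁻ none = inj₂
  join-∈⁻ (black {x} {l}) = ∈-++⁻ (x ∷ l)
  join-∈⁻ (red {m = m} refl) x∈ with ∈-++⁻ m x∈
  ... | inj₁ x∈m = inj₁ (∈-++⁺ˡ x∈m)
  ... | inj₂ x∈C = inj₂ x∈C

  join-∈ˡ : Join l e C D → l ⊆ D
  join-∈ˡ (black {x} {l}) = ∈-++⁺ˡ
  join-∈ˡ (red {m = m} refl) x∈ with ∈-++⁻ m x∈
  ... | inj₁ x∈m         = ∈-++⁺ˡ x∈m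
  ... | inj₂ (here refl) = ∈-++⁺ʳ m (here refl)

  join-∈ʳ : Join l e C D → C ⊆ D
  join-∈ʳ none = λ x∈ → x∈
  join-∈ʳ (black {x} {l}) = ∈-++⁺ʳ (x ∷ l)
  join-∈ʳ (red {m = m} _) = ∈-++⁺ʳ m

  ⊆-≢[] : ∀ {l C : List B} → l ⊆ C → l ≢ [] → C ≢ []
  ⊆-≢[] {[]}    _ ne refl = ne refl
  ⊆-≢[] {_ ∷ _} h _  refl with () ← h (here refl)

  join-asc : Join l e C D → Ascending D → Ascending l × Ascending C × l ⊲ C
  join-asc none a = [] , a , λ ()
  join-asc (black {x} {l}) a = let (p , q , r) = asc-++⁻ (x ∷ l) a in
    p , q , λ x∈ y∈ → inj₂ (r x∈ y∈)
  join-asc (red {m = m} {c} {C} refl) a with asc-++⁻ m a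
  ... | p , h ∷ q , r = asc-++⁺ p ([] ∷ []) (λ { x∈ (here refl) → r x∈ (here refl) }) , h ∷ q ,
    λ x∈ y∈ → order (∈-++⁻ m x∈) y∈
    where
    order : ∀ {x y} → x ∈ m ⊎ x ∈ [ c ] → y ∈ c ∷ C → x ≼ y
    order (inj₁ x∈)          y∈          = inj₂ (r x∈ y∈)
    order (inj₂ (here refl)) (here refl) = inj₁ refl
    order (inj₂ (here refl)) (there y∈)  = inj₂ (LAll.lookup h y∈)

  join-first : l ≢ [] → Join l e [] D → D ≡ l
  join-first ne none  = contradiction refl ne
  join-first ne black = List.++-identityʳ _

  ++-injective : ∀ (l l′ : List B) {C C′} → length l ≡ length l′ → l ++ C ≡ l′ ++ C′ → l ≡ l′ × C ≡ C′
  ++-injective []      []        _ eq = refl , eq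
  ++-injective (x ∷ l) (x′ ∷ l′) p eq =
    let (q , r) = ++-injective l l′ (ℕ.suc-injective p) (List.∷-injectiveʳ eq) in
    cong₂ _∷_ (List.∷-injectiveˡ eq) q , r

  -- The entry alone says where to cut: its size counts the boxes of the first piece, and its color
  -- tells whether the last of them also stays in the second piece.
  split-unique : ∀ {l l′ C C′ D D′ e} → Join l e C D → Join l′ e C′ D′ → D ≡ D′ → l ≡ l′ × C ≡ C′
  split-unique j j′ = go j j′ refl
    where
    -- The entries are compared by a propositional equality because `length l` and `m ++ c ∷ C` in
    -- the indices cannot be unified by matching.
    go : ∀ {l l′ C C′ D D′ e e′} → Join l e C D → Join l′ e′ C′ D′ → e ≡ e′ → D ≡ D′ → l ≡ l′ × C ≡ C′
    go none none _ eq = refl , eq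
    go (black {x} {l}) (black {x′} {l′}) p eq =
      ++-injective (x ∷ l) (x′ ∷ l′) (cong size p) eq
    go (red {m = m} refl) (red {m = m′} refl) p eq
      with ++-injective m m′ (ℕ.suc-injective (cong size p)) eq
    ... | refl , refl = refl , refl

  -- If both colors were possible, the last box of `l` would be the first box of `C`, and the
  -- ascending black join would put it strictly left of itself.
  join-unique : ∀ {l C D D′ e e′} → Ascending D → Ascending D′ →
                Join l e C D → Join l e′ C D′ → e ≡ e′ × D ≡ D′
  join-unique _ _ none  none  = refl , refl
  join-unique _ _ none  (red {m = m} eq) = contradiction eq ([]≢∷ʳ m)
  join-unique _ _ black black = refl , refl
  join-unique a _ (black {x} {l}) (red {m = m} {c} eq) =
    contradiction (proj₂ (proj₂ (asc-++⁻ (x ∷ l) a))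
      (subst (c ∈_) (sym eq) (∈-++⁺ʳ m (here refl))) (here refl)) (ℕ.<-irrefl refl)
  join-unique _ _ (red {m = m} eq) none = contradiction eq ([]≢∷ʳ m)
  join-unique _ a (red {m = m} {c} eq) (black {x} {l}) =
    contradiction (proj₂ (proj₂ (asc-++⁻ (x ∷ l) a))
      (subst (c ∈_) (sym eq) (∈-++⁺ʳ m (here refl))) (here refl)) (ℕ.<-irrefl refl)
  join-unique _ _ (red {m = m} eq) (red {m = m′} eq′)
    with refl ← List.∷ʳ-injectiveˡ m m′ (trans (sym eq) eq′) = refl , refl

  -- For nonempty `l` the color is found by comparing its last box with the first box of `C`. An
  -- empty `C` leaves only black, which is the origin of the black leading entry of a block.
  join-exists : ∀ l C → Ascending l → Ascending C → l ⊲ C →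
                ∃₂ λ e D → Join l e C D × Ascending D
  join-exists []      C       _  ac _ = nil , C , none , ac
  join-exists (x ∷ l) []      al ac _ =
    _ , _ , black , subst Ascending (sym (List.++-identityʳ _)) al
  join-exists l@(_ ∷ _) (c ∷ C) al ac h = go l (λ ()) al h
    where
    go : ∀ l → l ≢ [] → Ascending l → l ⊲ c ∷ C → ∃₂ λ e D → Join l e (c ∷ C) D × Ascending D
    go l ne al h with initLast l
    ... | [] = contradiction refl ne
    ... | m ∷ʳ′ d with h (∈-++⁺ʳ m (here refl)) (here refl)
    ...   | inj₁ refl =
      _ , _ , red refl , asc-++⁺ (proj₁ am) ac
        λ { x∈ (here refl) → proj₂ (proj₂ am) x∈ (here refl)
          ; x∈ (there y∈) → ℕ.<-trans (proj₂ (proj₂ am) x∈ (here refl)) (LAll.lookup (AllPairs.head ac) y∈) }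
      where am = asc-++⁻ m al
    ...   | inj₂ d<c  = join-black (m ∷ʳ d) ([]≢∷ʳ m ∘ sym) (asc-++⁺ al ac
        λ x∈ y∈ → ℕ.≤-<-trans (≤d (∈-++⁻ m x∈)) (ℕ.<-≤-trans d<c (c≤ y∈)))
      where
      join-black : ∀ l → l ≢ [] → Ascending (l ++ c ∷ C) → ∃₂ λ e D → Join l e (c ∷ C) D × Ascending D
      join-black []      ne _ = contradiction refl ne
      join-black (_ ∷ _) _  a = _ , _ , black , a
      am = asc-++⁻ m al
      ≤d : ∀ {x} → x ∈ m ⊎ x ∈ [ d ] → col x ℕ.≤ col d
      ≤d (inj₁ x∈)          = ℕ.<⇒≤ (proj₂ (proj₂ am) x∈ (here refl))
      ≤d (inj₂ (here refl)) = ℕ.≤-refl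
      c≤ : ∀ {y} → y ∈ c ∷ C → col c ℕ.≤ col y
      c≤ (here refl) = ℕ.≤-refl
      c≤ (there y∈)  = ℕ.<⇒≤ (LAll.lookup (AllPairs.head ac) y∈)

  split-at : ∀ k c (D : List B) → length D ≡ k + c →
             ∃₂ λ l C → length l ≡ k × length C ≡ c × D ≡ l ++ C
  split-at zero    c D       eq = [] , D , refl , eq , refl
  split-at (suc k) c (x ∷ D) eq =
    let (l , C , p , q , r) = split-at k c D (ℕ.suc-injective eq) in
    x ∷ l , C , cong suc p , q , cong (x ∷_) r

  split-exists : ∀ {e c d} D → JoinLength e c d → length D ≡ d →
                 ∃₂ λ l C → Join l e C D × length C ≡ c
  split-exists D none eq = [] , D , none , eq
  split-exists D (black {k} {c}) eq with split-at (suc k) c D eq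
  ... | x ∷ l , C , refl , q , refl = x ∷ l , C , black , q
  split-exists D (red {k} {c}) eq with split-at k (suc c) D eq
  ... | m , x ∷ C , refl , q , refl = m ∷ʳ x , x ∷ C , red refl , q

  -- Coarsenings and refinements of vectors of lists

  -- Labels are processed in increasing order; the carry C joins the lists
  -- of the labels of the current block seen so far.
  data Coarsens : ∀ {n} → List B → Vec (List B) n → Komposition n → Vec (List B) n → Set where
    done : Coarsens [] [] [] []
    hold : ∀ {l e C D} {L T : Vec (List B) n} {b} →
           Join l e C D → Coarsens D L b T → Coarsens C (l ∷ L) (e ∷ b) ([] ∷ T)
    emit : ∀ {l e C D} {L T : Vec (List B) n} {b} →
           Join l e C D → l ≢ [] → Coarsens [] L b T → Coarsens C (l ∷ L) (e ∷ b) (D ∷ T)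

  private
    variable
      L T : Vec (List B) n
      b : Komposition n

  coarsens-size : Coarsens C L b T → Vec.map length L ≡ underlying b
  coarsens-size done         = refl
  coarsens-size (hold j r)   = cong₂ _∷_ (join-size j) (coarsens-size r)
  coarsens-size (emit j _ r) = cong₂ _∷_ (join-size j) (coarsens-size r)

  -- A red entry marks one box that is counted twice on the left, in its own list and in the carry
  -- that it meets.
  coarsens-weight : Coarsens C L b T →
    Vec.sum (Vec.map length L) + length C ≡ Vec.sum (Vec.map length T) + ex b
  coarsens-weight done = refl
  coarsens-weight {C = C} {L = l ∷ L} {e ∷ b} {T = [] ∷ T} (hold {D = D} j r) = begin
    length l + ΣL + length C      ≡⟨ cong (_+ length C) (ℕ.+-comm (length l) ΣL) ⟩
    ΣL + length l + length C      ≡⟨ ℕ.+-assoc ΣL (length l) (length C) ⟩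
    ΣL + (length l + length C)    ≡⟨ cong (ΣL +_) (join-weight j) ⟩
    ΣL + (length D + redness e)   ≡⟨ ℕ.+-assoc ΣL (length D) (redness e) ⟨
    ΣL + length D + redness e     ≡⟨ cong (_+ redness e) (coarsens-weight r) ⟩
    ΣT + ex b + redness e         ≡⟨ ℕ.+-assoc ΣT (ex b) (redness e) ⟩
    ΣT + (ex b + redness e)       ≡⟨ cong (ΣT +_) (ℕ.+-comm (ex b) (redness e)) ⟩
    ΣT + (redness e + ex b)       ∎
    where
    open ≡-Reasoning
    ΣL = Vec.sum (Vec.map length L)
    ΣT = Vec.sum (Vec.map length T)
  coarsens-weight {C = C} {L = l ∷ L} {e ∷ b} {T = D ∷ T} (emit j _ r) = begin
    length l + ΣL + length C      ≡⟨ xy∙z≈xz∙y (length l) ΣL (length C) ⟩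
    length l + length C + ΣL      ≡⟨ cong₂ _+_ (join-weight j) (trans (sym (ℕ.+-identityʳ ΣL)) (coarsens-weight r)) ⟩
    length D + redness e + (ΣT + ex b)  ≡⟨ interchange (length D) (redness e) ΣT (ex b) ⟩
    length D + ΣT + (redness e + ex b)  ∎
    where
    open ≡-Reasoning
    ΣL = Vec.sum (Vec.map length L)
    ΣT = Vec.sum (Vec.map length T)

  coarsens⇒glide : Coarsens C L b T → Glide (length C) b (Vec.map length T)
  coarsens⇒glide done          = done
  coarsens⇒glide (hold j r)    = hold (join-length j) (coarsens⇒glide r)
  coarsens⇒glide (emit j ne r) = emit (join-length j) (join-≢nil j ne) (coarsens⇒glide r)

  -- The later labels are treated first: they return the carry `D`, which the current label cuts
  -- into its own list and the carry before it. At an `emit` the returned carry is empty and the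
  -- list to cut is `t`.
  refinement-exists : ∀ {c} (T : Vec (List B) n) → Glide c b (Vec.map length T) →
                      ∃₂ λ C L → length C ≡ c × Coarsens C L b T
  refinement-exists [] done = [] , [] , refl , done
  refinement-exists ([] ∷ T) (hold j g) =
    let (D , L , p , r) = refinement-exists T g
        (l , C , j′ , q) = split-exists D j p
    in C , l ∷ L , q , hold j′ r
  refinement-exists (t ∷ T) (emit j ne g) with refinement-exists T g
  ... | [] , L , _ , r =
    let (l , C , j′ , q) = split-exists t j refl
    in C , l ∷ L , q , emit j′ (join-nil j′ ne) r

  -- Each cut is forced by its entry. `hold` and `emit` cannot compete, since an emitted list
  -- contains a nonempty `l` whereas `hold` leaves `[]` in `T`.
  refinement-unique : ∀ {C′ L L′} {b : Komposition n} {T} →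
                      Coarsens C L b T → Coarsens C′ L′ b T → C ≡ C′ × L ≡ L′
  refinement-unique done done = refl , refl
  refinement-unique (hold j r) (hold j′ r′) with refinement-unique r r′
  ... | refl , refl with split-unique j j′ refl
  ...   | refl , refl = refl , refl
  refinement-unique (emit j ne r) (emit j′ ne′ r′) with refinement-unique r r′
  ... | refl , refl with split-unique j j′ refl
  ...   | refl , refl = refl , refl
  refinement-unique (hold _ _) (emit j ne _) = contradiction refl (⊆-≢[] (join-∈ˡ j) ne)
  refinement-unique (emit j ne _) (hold _ _) = contradiction refl (⊆-≢[] (join-∈ˡ j) ne)

  coarsens-asc : Coarsens C L b T → All Ascending T → Ascending C × All Ascending L
  coarsens-asc done _ = [] , []
  coarsens-asc (hold j r) (_ ∷ as) =
    let (p , q) = coarsens-asc r as ; (s , t , _) = join-asc j p in t , s ∷ q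
  coarsens-asc (emit j _ r) (a ∷ as) =
    let (_ , q) = coarsens-asc r as ; (s , t , _) = join-asc j a in t , s ∷ q

  -- Tight coarsenings: uniqueness and existence

  -- The counterpart of meson-highest for lists: no two consecutive nonempty lists can be merged any
  -- further.
  Tight : Vec (List B) n → Set
  Tight []      = ⊤
  Tight (t ∷ T) = (t ≢ [] → ∀ s → First s T → ¬ s ⊲ t) × Tight T

  -- Before the first nonempty list only `none` steps occur, and they hand the carry on unchanged,
  -- so it is this list that gets joined to `C`.
  hold-first : Coarsens C L b T → C ≢ [] → All Ascending T → ∃[ l ] First l L × l ⊲ C
  hold-first done ne _ = contradiction refl ne
  hold-first (hold none r) ne (_ ∷ as) =
    let (l , f , h) = hold-first r ne as in l , there f , h
  hold-first (hold j@black r) ne (_ ∷ as) =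
    _ , here (λ ()) , proj₂ (proj₂ (join-asc j (proj₁ (coarsens-asc r as))))
  hold-first (hold j@(red {m = m} refl) r) ne (_ ∷ as) =
    _ , here ([]≢∷ʳ m ∘ sym) , proj₂ (proj₂ (join-asc j (proj₁ (coarsens-asc r as))))
  hold-first (emit j lne r) ne (a ∷ as) = _ , here lne , proj₂ (proj₂ (join-asc j a))

  join-⊲ : Join l e C D → Ascending D → C ≢ [] → ∀ {E} → C ⊲ E → D ⊲ E
  join-⊲ j a ne h x∈ y∈ with join-∈⁻ j x∈
  ... | inj₁ x∈l = ⊲-trans ne (proj₂ (proj₂ (join-asc j a))) h x∈l y∈
  ... | inj₂ x∈C = h x∈C y∈

  -- Every later join only puts boxes in front of the carry, all of them `≼` the boxes of `C`, so a
  -- bound for `C` stays a bound for the finished list.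
  carry-bounds-first : Coarsens C L b T → C ≢ [] → All Ascending T →
                       ∃[ t ] First t T × (∀ {E} → C ⊲ E → t ⊲ E)
  carry-bounds-first done ne _ = contradiction refl ne
  carry-bounds-first (hold j r) ne (_ ∷ as) =
    let (t , f , h) = carry-bounds-first r (⊆-≢[] (join-∈ʳ j) ne) as in
    t , there f , λ p → h (join-⊲ j (proj₁ (coarsens-asc r as)) ne p)
  carry-bounds-first (emit j lne r) ne (a ∷ as) =
    _ , here (⊆-≢[] (join-∈ˡ j) lne) , join-⊲ j a ne

  first-bounds-first : Coarsens [] L b T → First l L → All Ascending T →
                       ∃[ t ] First t T × (∀ {E} → l ⊲ E → t ⊲ E)
  first-bounds-first (hold none r) (there f) (_ ∷ as) =
    let (t , g , h) = first-bounds-first r f as in t , there g , h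
  first-bounds-first (hold none r) (here ne) _ = contradiction refl ne
  first-bounds-first (hold j@black r) (here ne) (_ ∷ as) =
    let (t , g , h) = carry-bounds-first r (⊆-≢[] (join-∈ˡ j) ne) as in
    t , there g , λ p → h (λ {x} x∈ → p (subst (x ∈_) (join-first ne j) x∈))
  first-bounds-first (emit j lne r) (here ne) (a ∷ as) =
    _ , here (⊆-≢[] (join-∈ˡ j) ne) , λ p {x} x∈ → p (subst (x ∈_) (join-first ne j) x∈)
  first-bounds-first (emit j lne r) (there f) _ = contradiction refl lne

  -- Two scans that agree up to `D` cannot part there. The one that holds `D` shows that the next
  -- list of `L` is `⊲ D`; then so is the next list of `T` for the one that emits, against
  -- tightness.
  emit-vs-hold : ∀ {b′ T′} → Coarsens [] L b T → Coarsens D L b′ T′ → D ≢ [] →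
                 All Ascending T → All Ascending T′ →
                 ¬ (∀ s → First s T → ¬ s ⊲ D)
  emit-vs-hold r r′ ne as as′ tight =
    let (l , f , h) = hold-first r′ ne as′ ; (t , g , k) = first-bounds-first r f as in
    tight t g (k h)

  coarsening-unique : ∀ {b′ T′} → Coarsens C L b T → Coarsens C L b′ T′ →
                      All Ascending T → All Ascending T′ → Tight T → Tight T′ →
                      b ≡ b′ × T ≡ T′
  coarsening-unique done done _ _ _ _ = refl , refl
  coarsening-unique (hold j r) (hold j′ r′) (_ ∷ as) (_ ∷ as′) (_ , t) (_ , t′)
    with join-unique (proj₁ (coarsens-asc r as)) (proj₁ (coarsens-asc r′ as′)) j j′
  ... | refl , refl with coarsening-unique r r′ as as′ t t′
  ...   | refl , refl = refl , refl
  coarsening-unique (emit j ne r) (emit j′ _ r′) (a ∷ as) (a′ ∷ as′) (_ , t) (_ , t′)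
    with join-unique a a′ j j′
  ... | refl , refl with coarsening-unique r r′ as as′ t t′
  ...   | refl , refl = refl , refl
  coarsening-unique (hold j r) (emit j′ ne r′) (_ ∷ as) (a′ ∷ as′) _ (t′ , _)
    with join-unique (proj₁ (coarsens-asc r as)) a′ j j′
  ... | refl , refl =
    contradiction (t′ D≢[]) (emit-vs-hold r′ r D≢[] as′ as)
    where D≢[] = ⊆-≢[] (join-∈ˡ j) ne
  coarsening-unique (emit j ne r) (hold j′ r′) (a ∷ as) (_ ∷ as′) (t , _) _
    with join-unique a (proj₁ (coarsens-asc r′ as′)) j j′
  ... | refl , refl =
    contradiction (t D≢[]) (emit-vs-hold r r′ D≢[] as as′)
    where D≢[] = ⊆-≢[] (join-∈ˡ j) ne

  -- Tightness speaks of the lists of `T`, but a greedy scan tests only lists of `L`. This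
  -- containment transfers a failed test from `L` to `T`.
  first-contains : ∀ {s} → Coarsens C L b T → First s T →
                   C ⊆ s × (C ≡ [] → ∃[ l ] First l L × l ⊆ s)
  first-contains {C = C} (hold {l = l} j r) (there f) with l
  first-contains (hold none r) (there f) | [] =
    let (p , q) = first-contains r f in p , λ eq → let (l , g , h) = q eq in l , there g , h
  first-contains (hold (red {m = m} eq) r) (there f) | [] = contradiction eq ([]≢∷ʳ m)
  ... | x ∷ l = let (p , _) = first-contains r f in
    (λ x∈ → p (join-∈ʳ j x∈)) , λ _ → _ , here (λ ()) , λ x∈ → p (join-∈ˡ j x∈)
  first-contains (hold _ _) (here ne) = contradiction refl ne
  first-contains (emit j ne r) (here _)  = join-∈ʳ j , λ _ → _ , here ne , join-∈ˡ j
  first-contains (emit j ne r) (there f) = contradiction refl (⊆-≢[] (join-∈ˡ j) ne)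

  -- Greedy scan: hold while the next nonempty list can be joined to what has been collected, emit
  -- otherwise. The disjunction is the invariant that a nonempty carry always has a list ahead to
  -- receive it.
  coarsening-exists : ∀ C (L : Vec (List B) n) → Ascending C → All Ascending L →
                      C ≡ [] ⊎ (∃[ l ] First l L × l ⊲ C) →
                      ∃₂ λ b T → Coarsens C L b T × All Ascending T × Tight T
  coarsening-exists .[] [] _ _ (inj₁ refl) = [] , [] , done , [] , tt
  coarsening-exists C ([] ∷ L) aC (_ ∷ as) h
    with coarsening-exists C L aC as (continue h)
    where
    continue : C ≡ [] ⊎ (∃[ l ] First l ([] ∷ L) × l ⊲ C) → C ≡ [] ⊎ (∃[ l ] First l L × l ⊲ C)
    continue (inj₁ eq)                 = inj₁ eq
    continue (inj₂ (_ , here ne , _))  = contradiction refl ne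
    continue (inj₂ (l , there f , p))  = inj₂ (l , f , p)
  ... | b , T , r , asT , t = _ , _ , hold none r , [] ∷ asT , (λ ne → contradiction refl ne) , t
  coarsening-exists C (l@(_ ∷ _) ∷ L) aC (a ∷ as) h
    with join-exists l C a aC (below h)
    where
    below : C ≡ [] ⊎ (∃[ m ] First m (l ∷ L) × m ⊲ C) → l ⊲ C
    below (inj₁ refl) _ ()
    below (inj₂ (_ , here _ , p)) = p
  ... | e , D , j , aD with nextBelow?
    where
    nextBelow? : Dec (∃[ m ] First m L × m ⊲ D)
    nextBelow? with first? L
    ... | no  ∄m      = no λ (m , f , _) → ∄m (m , f)
    ... | yes (m , f) = map′ (λ (p : m ⊲ D) → m , f , λ {x} {y} → p {x} {y})
      (λ (m′ , f′ , p) → subst (_⊲ D) (first-unique f′ f) (λ {x} {y} → p {x} {y})) (m ⊲? D)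
  ...   | yes next =
    let (b , T , r , asT , t) = coarsening-exists D L aD as (inj₂ next) in
    _ , _ , hold j r , [] ∷ asT , (λ ne → contradiction refl ne) , t
  ...   | no ¬next =
    let (b , T , r , asT , t) = coarsening-exists [] L [] as (inj₁ refl) in
    _ , _ , emit j (λ ()) r , aD ∷ asT ,
    (λ _ _ f s⊲D → let (m , g , m⊆s) = proj₂ (first-contains r f) refl in
      ¬next (m , g , λ x∈ → s⊲D (m⊆s x∈))) , t

  -- How boxes and labels move under a coarsening

  raise-carry : Coarsens C L b T → ∀ {x} → x ∈ C → ∃[ z ] FirstAt T z × x ∈ lookup T z
  raise-carry (hold j r) x∈ = let (z , f , p) = raise-carry r (join-∈ʳ j x∈) in suc z , there f , p
  raise-carry (emit j ne r) x∈ = zero , here (⊆-≢[] (join-∈ˡ j) ne) , join-∈ʳ j x∈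

  raise : Coarsens C L b T → ∀ i {x} → x ∈ lookup L i → ∃[ z ] Top T i z × x ∈ lookup T z
  raise (hold j r) zero x∈ =
    let (z , f , p) = raise-carry r (join-∈ˡ j x∈) in suc z , start (there f) , p
  raise (emit j ne r) zero x∈ = zero , start (here (⊆-≢[] (join-∈ˡ j) ne)) , join-∈ˡ j x∈
  raise (hold j r)   (suc i) x∈ = let (z , t , p) = raise r i x∈ in suc z , step t , p
  raise (emit j _ r) (suc i) x∈ = let (z , t , p) = raise r i x∈ in suc z , step t , p

  -- The first alternative accounts for the boxes that labels scanned earlier have left in the
  -- carry.
  lower : Coarsens C L b T → ∀ z {x} → x ∈ lookup T z →
          (FirstAt T z × x ∈ C) ⊎ (∃[ i ] Top T i z × x ∈ lookup L i)
  lower (hold j r) (suc z) x∈ with lower r z x∈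
  ... | inj₂ (i , t , p) = inj₂ (suc i , step t , p)
  ... | inj₁ (f , p) with join-∈⁻ j p
  ...   | inj₁ q = inj₂ (zero , start (there f) , q)
  ...   | inj₂ q = inj₁ (there f , q)
  lower (emit j ne r) zero x∈ with join-∈⁻ j x∈
  ...   | inj₁ q = inj₂ (zero , start (here (⊆-≢[] (join-∈ˡ j) ne)) , q)
  ...   | inj₂ q = inj₁ (here (⊆-≢[] (join-∈ˡ j) ne) , q)
  lower (emit j ne r) (suc z) x∈ with lower r z x∈
  ... | inj₂ (i , t , p) = inj₂ (suc i , step t , p)

  block-carry : Coarsens C L b T → All Ascending T → ∀ {i z} → FirstAt T z → Top T i z →
                lookup L i ⊲ C
  block-carry (hold j r) (_ ∷ as) {zero}  (there f) (start _) =
    proj₂ (proj₂ (join-asc j (proj₁ (coarsens-asc r as))))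
  block-carry (hold j r) (_ ∷ as) {suc i} (there f) (step t) x∈ y∈ =
    block-carry r as f t x∈ (join-∈ʳ j y∈)
  block-carry (hold _ _) _ (here ne) _ = contradiction refl ne
  block-carry (emit j ne r) (a ∷ _) (here _) (start _) = proj₂ (proj₂ (join-asc j a))
  block-carry (emit j ne r) (a ∷ as) (there f) t = contradiction refl (⊆-≢[] (join-∈ˡ j) ne)

  -- When the list of `k` is joined, the carry already contains the lists of all smaller labels of
  -- the block.
  block-⊲ : Coarsens C L b T → All Ascending T → ∀ {i k z} → i < k → Top T i z → Top T k z →
            lookup L k ⊲ lookup L i
  block-⊲ (hold j r) (_ ∷ as) {zero} {suc k} _ (start (there f)) (step t) x∈ y∈ =
    block-carry r as f t x∈ (join-∈ˡ j y∈)
  block-⊲ (emit j ne r) _ {zero} {suc k} _ (start (there f)) (step t) =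
    contradiction refl (⊆-≢[] (join-∈ˡ j) ne)
  block-⊲ (hold j r)   (_ ∷ as) {suc i} {suc k} (s≤s i<k) (step t) (step u) = block-⊲ r as i<k t u
  block-⊲ (emit j _ r) (_ ∷ as) {suc i} {suc k} (s≤s i<k) (step t) (step u) = block-⊲ r as i<k t u

  -- The condition `l ≢ []` in `emit` corresponds to the nonzero last entry of a block of a mesonic
  -- glide. Thanks to it labels are raised only to labels that occur already.
  lookup-≢[] : Coarsens C L b T → ∀ z → lookup T z ≢ [] → lookup L z ≢ []
  lookup-≢[] (hold j r)    zero    ne = contradiction refl ne
  lookup-≢[] (emit j ne r) zero    _  = ne
  lookup-≢[] (hold j r)    (suc z) ne = lookup-≢[] r z ne
  lookup-≢[] (emit j _ r)  (suc z) ne = lookup-≢[] r z ne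

-- Mesonic glides as scans with a carry

FirstBlock : Vec ℕ n → Fin n → Set
FirstBlock w p = ∀ q → q < p → lookup w q ≡ 0

firstBlock-suc : {w : Vec ℕ n} {p : Fin n} → FirstBlock w p → FirstBlock (0 ∷ w) (suc p)
firstBlock-suc h zero    _         = refl
firstBlock-suc h (suc q) (s≤s q<p) = h q q<p

firstNonzero : (w : Vec ℕ n) →
  (∀ p → lookup w p ≡ 0) ⊎ (∃[ p ] lookup w p ≢ 0 × FirstBlock w p)
firstNonzero [] = inj₁ λ ()
firstNonzero (suc x ∷ w) = inj₂ (zero , (λ ()) , λ _ ())
firstNonzero (zero ∷ w) with firstNonzero w
... | inj₁ h           = inj₁ λ { zero → refl ; (suc p) → h p }
... | inj₂ (p , ne , h) = inj₂ (suc p , ne , firstBlock-suc {w = w} h)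

module _ {x : ℕ} {w : Vec ℕ n} {p : Fin n} where

  inBlock-suc⁺ : ∀ {k} → InBlock w p k → InBlock (x ∷ w) (suc p) (suc k)
  inBlock-suc⁺ (k≤p , h) = s≤s k≤p ,
    λ { zero _ _ → s≤s z≤n ; (suc q) (s≤s q<p) ne → s≤s (h q q<p ne) }

  inBlock-suc⁻ : ∀ {k} → InBlock (x ∷ w) (suc p) (suc k) → InBlock w p k
  inBlock-suc⁻ (s≤s k≤p , h) = k≤p , λ q q<p ne → s≤s⁻¹ (h (suc q) (s≤s q<p) ne)

  inBlock-zero⁻ : InBlock (x ∷ w) (suc p) zero → x ≡ 0 × FirstBlock w p
  inBlock-zero⁻ (_ , h) = zero? x (h zero (s≤s z≤n)) , λ q q<p → zero? _ (h (suc q) (s≤s q<p))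
    where
    zero? : ∀ y {k} → (y ≢ 0 → k ℕ.< 0) → y ≡ 0
    zero? zero    _ = refl
    zero? (suc y) h with () ← h (λ ())

inBlock-zero⁺ : {w : Vec ℕ n} {p : Fin n} → FirstBlock w p → InBlock (0 ∷ w) (suc p) zero
inBlock-zero⁺ h = z≤n , λ
  { zero _ ne → contradiction refl ne ; (suc q) (s≤s q<p) ne → contradiction (h q q<p) ne }

inBlock-head : {x : ℕ} {w : Vec ℕ n} → InBlock (x ∷ w) zero zero
inBlock-head = z≤n , λ _ ()

module _ (f : Entry → ℕ) (e : Entry) (b : Komposition n) where

  sumOver-filter-suc : ∀ {P : Fin (suc n) → Set} {Q : Fin n → Set}
    (P? : ∀ k → Dec (P k)) (Q? : ∀ k → Dec (Q k)) →
    (∀ {k} → P (suc k) → Q k) → (∀ {k} → Q k → P (suc k)) → ∀ ks →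
    sumOver (filter P? (List.map suc ks)) f (e ∷ b) ≡ sumOver (filter Q? ks) f b
  sumOver-filter-suc P? Q? to from [] = refl
  sumOver-filter-suc P? Q? to from (k ∷ ks) with P? (suc k) | Q? k
  ... | yes _ | yes _ = cong (f (lookup b k) +_) (sumOver-filter-suc P? Q? to from ks)
  ... | no  _ | no  _ = sumOver-filter-suc P? Q? to from ks
  ... | yes p | no ¬q = contradiction (to p) ¬q
  ... | no ¬p | yes q = contradiction (from q) ¬p

  sumOver-none : ∀ {P : Fin (suc n) → Set} (P? : ∀ k → Dec (P k)) →
    (∀ {k} → ¬ P (suc k)) → ∀ ks → sumOver (filter P? (List.map suc ks)) f (e ∷ b) ≡ 0
  sumOver-none P? ¬P [] = refl
  sumOver-none P? ¬P (k ∷ ks) with P? (suc k)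
  ... | yes p = contradiction p ¬P
  ... | no  _ = sumOver-none P? ¬P ks

  module _ (x : ℕ) (w : Vec ℕ n) where

    private
      tail : ∀ p → sumOver (filter (inBlock? (x ∷ w) (suc p)) (List.tabulate suc)) f (e ∷ b)
                   ≡ sumOver (block w p) f b
      tail p = trans
        (cong (λ ks → sumOver (filter (inBlock? (x ∷ w) (suc p)) ks) f (e ∷ b))
          (sym (List.map-tabulate (λ k → k) suc)))
        (sumOver-filter-suc (inBlock? (x ∷ w) (suc p)) (inBlock? w p)
          (inBlock-suc⁻ {x = x}) inBlock-suc⁺ (allFin n))

    sumOver-block-head : sumOver (block (x ∷ w) zero) f (e ∷ b) ≡ f e
    sumOver-block-head = begin
      sumOver (block (x ∷ w) zero) f (e ∷ b)
        ≡⟨ cong (λ ks → sumOver ks f (e ∷ b)) (List.filter-accept P? inBlock-head) ⟩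
      f e + sumOver (filter P? (List.tabulate suc)) f (e ∷ b)
        ≡⟨ cong (λ ks → f e + sumOver (filter P? ks) f (e ∷ b)) (List.map-tabulate (λ k → k) suc) ⟨
      f e + sumOver (filter P? (List.map suc (allFin n))) f (e ∷ b)
        ≡⟨ cong (f e +_) (sumOver-none P? (λ ()) (allFin n)) ⟩
      f e + 0
        ≡⟨ ℕ.+-identityʳ (f e) ⟩
      f e ∎
      where
      open ≡-Reasoning
      P? = inBlock? (x ∷ w) zero

    sumOver-block-out : ∀ p → ¬ InBlock (x ∷ w) (suc p) zero →
      sumOver (block (x ∷ w) (suc p)) f (e ∷ b) ≡ sumOver (block w p) f b
    sumOver-block-out p 0∉ = trans
      (cong (λ ks → sumOver ks f (e ∷ b)) (List.filter-reject (inBlock? (x ∷ w) (suc p)) 0∉))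
      (tail p)

    sumOver-block-in : ∀ p → InBlock (x ∷ w) (suc p) zero →
      sumOver (block (x ∷ w) (suc p)) f (e ∷ b) ≡ f e + sumOver (block w p) f b
    sumOver-block-in p 0∈ = trans
      (cong (λ ks → sumOver ks f (e ∷ b)) (List.filter-accept (inBlock? (x ∷ w) (suc p)) 0∈))
      (cong (f e +_) (tail p))

module _ (f : Entry → ℕ) (f-nil : f nil ≡ 0) (b : Komposition n) where

  sumOver-block-nil : ∀ x w p →
    sumOver (block (x ∷ w) (suc p)) f (nil ∷ b) ≡ sumOver (block w p) f b
  sumOver-block-nil x w p with inBlock? (x ∷ w) (suc p) zero
  ... | no 0∉  = sumOver-block-out f nil b x w p 0∉
  ... | yes 0∈ = trans (sumOver-block-in f nil b x w p 0∈)
                       (cong (_+ sumOver (block w p) f b) f-nil)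

-- A carry of length c acts on the rest of a mesonic glide like one more
-- black entry c in front of it.
carried : ℕ → Entry
carried zero    = nil
carried (suc c) = part black c

carried-size : ∀ c → size (carried c) ≡ c
carried-size zero    = refl
carried-size (suc c) = refl

carried-redness : ∀ c → redness (carried c) ≡ 0
carried-redness zero    = refl
carried-redness (suc c) = refl

carried-black : ∀ c → carried c ≢ nil → ∃[ m ] carried c ≡ part black m
carried-black zero    ne = contradiction refl ne
carried-black (suc c) _  = c , refl

joinLength-weight : ∀ {e c d} → JoinLength e c d → c + size e ≡ d + redness e
joinLength-weight none = refl
joinLength-weight {c = c} (black {k}) =
  trans (ℕ.+-comm c (suc k)) (sym (ℕ.+-identityʳ _))
joinLength-weight (red {k} {c}) = begin
  suc c + suc k    ≡⟨ ℕ.+-suc (suc c) k ⟩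
  suc (suc c + k)  ≡⟨ cong suc (ℕ.+-comm (suc c) k) ⟩
  suc (k + suc c)  ≡⟨ ℕ.+-comm 1 _ ⟩
  k + suc c + 1    ∎
  where open ≡-Reasoning

joinLength-nil⁻ : ∀ {e c d} → JoinLength e c d → carried d ≡ nil → carried c ≡ nil × e ≡ nil
joinLength-nil⁻ none eq = eq , refl
-- The length `k + suc c` reveals itself as a successor only after `k` is split.
joinLength-nil⁻ (red {zero}) ()
joinLength-nil⁻ (red {suc k}) ()

joinLength-nil⁺ : ∀ {e c d} → JoinLength e c d → carried c ≡ nil → e ≡ nil → carried d ≡ nil
joinLength-nil⁺ none eq _ = eq

-- A red entry needs a nonempty carry with which to share a box; this yields the black leading
-- entry.
joinLength-black : ∀ {e c d} → JoinLength e c d → carried c ≡ nil → e ≢ nil → ∃[ m ] e ≡ part black m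
joinLength-black none  _ ne = contradiction refl ne
joinLength-black black _ _  = _ , refl

joinLength-≢0 : ∀ {e c d} → JoinLength e c d → e ≢ nil → d ≢ 0
joinLength-≢0 none ne _ = ne refl
joinLength-≢0 (red {zero}) _ ()
joinLength-≢0 (red {suc k}) _ ()

module _ {w : Vec ℕ n} {b : Komposition n} where
  open MesonicGlide

  nil∷-mesonic⁺ : MesonicGlide w b → MesonicGlide (0 ∷ w) (nil ∷ b)
  nil∷-mesonic⁺ G .vanishing zero    h = refl
  nil∷-mesonic⁺ G .vanishing (suc k) h = vanishing G k λ p ne → s≤s⁻¹ (h (suc p) ne)
  nil∷-mesonic⁺ G .total zero    ne = contradiction refl ne
  nil∷-mesonic⁺ G .total (suc p) ne
    rewrite sumOver-block-nil redness refl b 0 w p | sumOver-block-nil size refl b 0 w p = total G p ne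
  nil∷-mesonic⁺ G .leading zero ne = contradiction refl ne
  nil∷-mesonic⁺ G .leading (suc p) ne zero    ib nz h = contradiction refl nz
  nil∷-mesonic⁺ G .leading (suc p) ne (suc k) ib nz h =
    leading G p ne k (inBlock-suc⁻ ib) nz λ q ib′ q<k → h (suc q) (inBlock-suc⁺ ib′) (s≤s q<k)
  nil∷-mesonic⁺ G .end zero    ne = contradiction refl ne
  nil∷-mesonic⁺ G .end (suc p) ne = end G p ne

  nil∷-mesonic⁻ : MesonicGlide (0 ∷ w) (nil ∷ b) → MesonicGlide w b
  nil∷-mesonic⁻ G .vanishing k h = vanishing G (suc k)
    λ { zero ne → contradiction refl ne ; (suc p) ne → s≤s (h p ne) }
  nil∷-mesonic⁻ G .total p ne = subst₂ (λ r s → lookup w p + r ≡ s)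
    (sumOver-block-nil redness refl b 0 w p) (sumOver-block-nil size refl b 0 w p) (total G (suc p) ne)
  nil∷-mesonic⁻ G .leading p ne k ib nz h = leading G (suc p) ne (suc k) (inBlock-suc⁺ ib) nz
    λ { zero _ _ → refl ; (suc q) ib′ (s≤s q<k) → h q (inBlock-suc⁻ ib′) q<k }
  nil∷-mesonic⁻ G .end p = end G (suc p)

  private
    in-block₀ : ∀ {p} → InBlock (0 ∷ w) (suc p) zero → InBlock (0 ∷ 0 ∷ w) (suc (suc p)) zero
    in-block₀ ib = inBlock-zero⁺ (firstBlock-suc {w = w} (proj₂ (inBlock-zero⁻ ib)))

    in-block₁ : ∀ {x p} → InBlock (0 ∷ x ∷ w) (suc (suc p)) zero → x ≡ 0 × InBlock (x ∷ w) (suc p) zero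
    in-block₁ ib = proj₂ (inBlock-zero⁻ ib) zero (s≤s z≤n) ,
      z≤n , λ q q<p ne → contradiction (proj₂ (inBlock-zero⁻ ib) q q<p) ne

    shift-weight : ∀ {e c d} → JoinLength e c d → ∀ v R S →
      v + (redness (carried c) + (redness e + R)) ≡ redness e + (v + (redness (carried d) + R)) ×
      size (carried c) + (size e + S) ≡ redness e + (size (carried d) + S)
    shift-weight {e} {c} {d} j v R S
      rewrite carried-redness c | carried-redness d | carried-size c | carried-size d =
      x∙yz≈y∙xz v (redness e) R , (begin
        c + (size e + S)     ≡⟨ ℕ.+-assoc c (size e) S ⟨
        c + size e + S       ≡⟨ cong (_+ S) (joinLength-weight j) ⟩
        d + redness e + S    ≡⟨ ℕ.+-assoc d (redness e) S ⟩
        d + (redness e + S)  ≡⟨ x∙yz≈y∙xz d (redness e) S ⟩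
        redness e + (d + S)  ∎)
      where open ≡-Reasoning

    module _ {e : Entry} {c d : ℕ} (j : JoinLength e c d) (p : Fin n) where

      Long Short : (Entry → ℕ) → ℕ
      Long f  = sumOver (block (0 ∷ 0 ∷ w) (suc (suc p))) f (carried c ∷ e ∷ b)
      Short f = sumOver (block (0 ∷ w) (suc p)) f (carried d ∷ b)

      -- Merging `carried c` and `e` into `carried d` lowers both sides of the total by `redness e`
      -- if the block contains the merged positions, and by 0 otherwise. Adding or cancelling `r`
      -- then gives the two directions.
      shift-total : ∃[ r ] lookup w p + Long redness ≡ r + (lookup w p + Short redness) ×
                           Long size ≡ r + Short size
      shift-total with inBlock? (0 ∷ w) (suc p) zero
      ... | yes ib = redness e ,
        trans (cong (lookup w p +_) (long redness)) (trans (proj₁ weights)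
          (cong (λ s → redness e + (lookup w p + s)) (sym (short redness)))) ,
        trans (long size) (trans (proj₂ weights) (cong (redness e +_) (sym (short size))))
        where
        S = λ f → sumOver (block w p) f b
        weights = shift-weight j (lookup w p) (S redness) (S size)
        long : ∀ f → Long f ≡ f (carried c) + (f e + S f)
        long f = trans (sumOver-block-in f (carried c) (e ∷ b) 0 (0 ∷ w) (suc p) (in-block₀ ib))
                       (cong (f (carried c) +_) (sumOver-block-in f e b 0 w p ib))
        short : ∀ f → Short f ≡ f (carried d) + S f
        short f = sumOver-block-in f (carried d) b 0 w p ib
      ... | no ¬ib = 0 , cong (lookup w p +_) (same redness) , same size
        where
        same : ∀ f → Long f ≡ Short f
        same f = trans (sumOver-block-out f (carried c) (e ∷ b) 0 (0 ∷ w) (suc p) (¬ib ∘ proj₂ ∘ in-block₁))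
                (trans (sumOver-block-out f e b 0 w p ¬ib)
                  (sym (sumOver-block-out f (carried d) b 0 w p ¬ib)))

      shift-total⁺ : lookup w p + Short redness ≡ Short size → lookup w p + Long redness ≡ Long size
      shift-total⁺ eq = let (r , u , v) = shift-total in trans u (trans (cong (r +_) eq) (sym v))

      shift-total⁻ : lookup w p + Long redness ≡ Long size → lookup w p + Short redness ≡ Short size
      shift-total⁻ eq = let (r , u , v) = shift-total in
        ℕ.+-cancelˡ-≡ r _ _ (trans (sym u) (trans eq v))

  module _ {e : Entry} {c d : ℕ} where

    -- The entry `e` is absorbed into the carry. As `carried d` is nil exactly when `carried c` and
    -- `e` are, the search for the leading entry continues beyond the merged positions in the same
    -- cases. If it stops there, it meets the carry, black by construction, or `e` after an empty
    -- carry, which is black too.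
    hold-mesonic⁺ : JoinLength e c d → MesonicGlide (0 ∷ w) (carried d ∷ b) →
                    MesonicGlide (0 ∷ 0 ∷ w) (carried c ∷ e ∷ b)
    hold-mesonic⁺ j G .vanishing zero h = proj₁ (joinLength-nil⁻ j (vanishing G zero
      λ { zero ne → contradiction refl ne ; (suc p) ne → contradiction (h (suc (suc p)) ne) λ () }))
    hold-mesonic⁺ j G .vanishing (suc zero) h = proj₂ (joinLength-nil⁻ j (vanishing G zero
      λ { zero ne → contradiction refl ne ; (suc p) ne → contradiction (h (suc (suc p)) ne) λ { (s≤s ()) } }))
    hold-mesonic⁺ j G .vanishing (suc (suc k)) h = vanishing G (suc k)
      λ { zero ne → contradiction refl ne ; (suc p) ne → s≤s⁻¹ (h (suc (suc p)) ne) }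
    hold-mesonic⁺ j G .total zero ne = contradiction refl ne
    hold-mesonic⁺ j G .total (suc zero) ne = contradiction refl ne
    hold-mesonic⁺ j G .total (suc (suc p)) ne = shift-total⁺ j p (total G (suc p) ne)
    hold-mesonic⁺ j G .leading zero ne = contradiction refl ne
    hold-mesonic⁺ j G .leading (suc zero) ne = contradiction refl ne
    hold-mesonic⁺ j G .leading (suc (suc p)) ne zero ib nz h = carried-black c nz
    hold-mesonic⁺ j G .leading (suc (suc p)) ne (suc zero) ib nz h =
      joinLength-black j (h zero (in-block₀ (inBlock-suc⁻ ib)) (s≤s z≤n)) nz
    hold-mesonic⁺ j G .leading (suc (suc p)) ne (suc (suc k)) ib nz h =
      leading G (suc p) ne (suc k) (inBlock-suc⁻ ib) nz λ
        { zero ib′ _ → joinLength-nil⁺ j (h zero (in-block₀ ib′) (s≤s z≤n))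
                         (h (suc zero) (inBlock-suc⁺ ib′) (s≤s (s≤s z≤n)))
        ; (suc q) ib′ q<k → h (suc (suc q)) (inBlock-suc⁺ ib′) (s≤s q<k) }
    hold-mesonic⁺ j G .end zero ne = contradiction refl ne
    hold-mesonic⁺ j G .end (suc zero) ne = contradiction refl ne
    hold-mesonic⁺ j G .end (suc (suc p)) ne = end G (suc p) ne

    hold-mesonic⁻ : JoinLength e c d → MesonicGlide (0 ∷ 0 ∷ w) (carried c ∷ e ∷ b) →
                    MesonicGlide (0 ∷ w) (carried d ∷ b)
    hold-mesonic⁻ j G .vanishing zero h = joinLength-nil⁺ j
      (vanishing G zero λ { zero ne → contradiction refl ne ; (suc zero) ne → contradiction refl ne
                          ; (suc (suc p)) ne → contradiction (h (suc p) ne) λ () })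
      (vanishing G (suc zero) λ { zero ne → contradiction refl ne ; (suc zero) ne → contradiction refl ne
                          ; (suc (suc p)) ne → contradiction (h (suc p) ne) λ () })
    hold-mesonic⁻ j G .vanishing (suc k) h = vanishing G (suc (suc k))
      λ { zero ne → contradiction refl ne ; (suc p) ne → s≤s (h p ne) }
    hold-mesonic⁻ j G .total zero ne = contradiction refl ne
    hold-mesonic⁻ j G .total (suc p) ne = shift-total⁻ j p (total G (suc (suc p)) ne)
    hold-mesonic⁻ j G .leading zero ne = contradiction refl ne
    hold-mesonic⁻ j G .leading (suc p) ne zero ib nz h = carried-black d nz
    hold-mesonic⁻ j G .leading (suc p) ne (suc k) ib nz h =
      leading G (suc (suc p)) ne (suc (suc k)) (inBlock-suc⁺ ib) nz λ
        { zero ib′ _ → proj₁ (joinLength-nil⁻ j (h zero (proj₂ (in-block₁ ib′)) (s≤s z≤n)))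
        ; (suc zero) ib′ _ → proj₂ (joinLength-nil⁻ j (h zero (inBlock-suc⁻ ib′) (s≤s z≤n)))
        ; (suc (suc q)) ib′ (s≤s q<k) → h (suc q) (inBlock-suc⁻ ib′) q<k }
    hold-mesonic⁻ j G .end zero ne = contradiction refl ne
    hold-mesonic⁻ j G .end (suc p) ne = end G (suc (suc p)) ne

  private
    not-first : ∀ {x p} → x ≢ 0 → ¬ InBlock (x ∷ w) (suc p) zero
    not-first x≢0 ib = x≢0 (proj₁ (inBlock-zero⁻ ib))

    not-first₂ : ∀ {x p} → x ≢ 0 → ¬ InBlock (0 ∷ x ∷ w) (suc (suc p)) zero
    not-first₂ x≢0 ib = x≢0 (proj₁ (in-block₁ ib))

    first : ∀ {x} → InBlock (0 ∷ x ∷ w) (suc zero) zero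
    first = z≤n , λ { zero _ ne → contradiction refl ne ; (suc q) (s≤s ()) }

    drop₂ : ∀ f {x e c p} → x ≢ 0 →
      sumOver (block (0 ∷ x ∷ w) (suc (suc p))) f (carried c ∷ e ∷ b) ≡ sumOver (block w p) f b
    drop₂ f {x} {e} {c} {p} x≢0 = trans
      (sumOver-block-out f (carried c) (e ∷ b) 0 (x ∷ w) (suc p) (not-first₂ x≢0))
      (sumOver-block-out f e b x w p (not-first x≢0))

    take₂ : ∀ f {x e c} →
      sumOver (block (0 ∷ x ∷ w) (suc zero)) f (carried c ∷ e ∷ b) ≡ f (carried c) + f e
    take₂ f {x} {e} {c} = trans
      (sumOver-block-in f (carried c) (e ∷ b) 0 (x ∷ w) zero first)
      (cong (f (carried c) +_) (sumOver-block-head f e b x w))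

  module _ {e : Entry} {c d : ℕ} where

    -- The carry and `e` form a whole block, with total `joinLength-weight`; the rest starts afresh
    -- with no carry.
    emit-mesonic⁺ : JoinLength e c d → e ≢ nil → MesonicGlide w b →
                    MesonicGlide (0 ∷ d ∷ w) (carried c ∷ e ∷ b)
    emit-mesonic⁺ j e≢ G .vanishing zero h =
      contradiction (h (suc zero) (joinLength-≢0 j e≢)) λ ()
    emit-mesonic⁺ j e≢ G .vanishing (suc zero) h =
      contradiction (h (suc zero) (joinLength-≢0 j e≢)) (ℕ.<-irrefl refl)
    emit-mesonic⁺ j e≢ G .vanishing (suc (suc k)) h =
      vanishing G k λ p ne → s≤s⁻¹ (s≤s⁻¹ (h (suc (suc p)) ne))
    emit-mesonic⁺ j e≢ G .total zero ne = contradiction refl ne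
    emit-mesonic⁺ j e≢ G .total (suc zero) ne
      rewrite take₂ redness {d} {e} {c} | take₂ size {d} {e} {c} | carried-redness c | carried-size c =
      sym (joinLength-weight j)
    emit-mesonic⁺ j e≢ G .total (suc (suc p)) ne
      rewrite drop₂ redness {d} {e} {c} {p} (joinLength-≢0 j e≢)
            | drop₂ size {d} {e} {c} {p} (joinLength-≢0 j e≢) = total G p ne
    emit-mesonic⁺ j e≢ G .leading zero ne = contradiction refl ne
    emit-mesonic⁺ j e≢ G .leading (suc p) ne zero ib nz h = carried-black c nz
    emit-mesonic⁺ j e≢ G .leading (suc zero) ne (suc zero) ib nz h =
      joinLength-black j (h zero first (s≤s z≤n)) nz
    emit-mesonic⁺ j e≢ G .leading (suc zero) ne (suc (suc k)) (s≤s () , _) nz h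
    emit-mesonic⁺ j e≢ G .leading (suc (suc p)) ne (suc zero) ib nz h =
      contradiction (inBlock-suc⁻ ib) (not-first (joinLength-≢0 j e≢))
    emit-mesonic⁺ j e≢ G .leading (suc (suc p)) ne (suc (suc k)) ib nz h =
      leading G p ne k (inBlock-suc⁻ (inBlock-suc⁻ ib)) nz
        λ q ib′ q<k → h (suc (suc q)) (inBlock-suc⁺ (inBlock-suc⁺ ib′)) (s≤s (s≤s q<k))
    emit-mesonic⁺ j e≢ G .end zero ne = contradiction refl ne
    emit-mesonic⁺ j e≢ G .end (suc zero) ne = e≢
    emit-mesonic⁺ j e≢ G .end (suc (suc p)) ne = end G p ne

    emit-mesonic⁻ : MesonicGlide (0 ∷ suc d ∷ w) (carried c ∷ e ∷ b) → MesonicGlide w b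
    emit-mesonic⁻ G .vanishing k h = vanishing G (suc (suc k))
      λ { zero _ → s≤s z≤n ; (suc zero) _ → s≤s (s≤s z≤n) ; (suc (suc p)) ne → s≤s (s≤s (h p ne)) }
    emit-mesonic⁻ G .total p ne = subst₂ (λ r s → lookup w p + r ≡ s)
      (drop₂ redness {suc d} {e} {c} {p} λ ()) (drop₂ size {suc d} {e} {c} {p} λ ()) (total G (suc (suc p)) ne)
    emit-mesonic⁻ G .leading p ne k ib nz h =
      leading G (suc (suc p)) ne (suc (suc k)) (inBlock-suc⁺ (inBlock-suc⁺ ib)) nz λ
        { zero ib′ _ → contradiction ib′ (not-first₂ λ ())
        ; (suc zero) ib′ _ → contradiction (inBlock-suc⁻ ib′) (not-first λ ())
        ; (suc (suc q)) ib′ (s≤s (s≤s q<k)) → h q (inBlock-suc⁻ (inBlock-suc⁻ ib′)) q<k }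
    emit-mesonic⁻ G .end p = end G (suc (suc p))

  -- The total of the block consisting of the carry and `e` fixes the joined length, and `leading`
  -- excludes a red `e` after an empty carry.
  emit-length : ∀ {d c} e → MesonicGlide (0 ∷ suc d ∷ w) (carried c ∷ e ∷ b) →
                JoinLength e c (suc d) × e ≢ nil
  emit-length {d} {c} e G = go e c G weight , end G (suc zero) (λ ())
    where
    weight : suc d + redness e ≡ c + size e
    weight with total G (suc zero) (λ ())
    ... | eq rewrite take₂ redness {suc d} {e} {c} | take₂ size {suc d} {e} {c}
                   | carried-redness c | carried-size c = eq

    go : ∀ e c → MesonicGlide (0 ∷ suc d ∷ w) (carried c ∷ e ∷ b) →
         suc d + redness e ≡ c + size e → JoinLength e c (suc d)
    go nil c G _ = contradiction refl (end G (suc zero) (λ ()))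
    go (part black k) c G eq = subst (JoinLength (part black k) c)
      (trans (ℕ.+-comm (suc k) c) (trans (sym eq) (ℕ.+-identityʳ _))) black
    go (part red k) zero G eq with leading G (suc zero) (λ ()) (suc zero)
      (ℕ.≤-refl , λ { zero _ ne → contradiction refl ne ; (suc q) (s≤s ()) }) (λ ())
      (λ { zero _ _ → refl ; (suc q) _ (s≤s ()) })
    ... | _ , ()
    go (part red k) (suc c) G eq = subst (JoinLength (part red k) (suc c))
      (ℕ.+-cancelʳ-≡ 1 _ _ (trans (sym (joinLength-weight (red {k} {c}))) (sym eq))) red

  -- Only a red entry after an empty carry has no join. It would be the leading entry of the next
  -- block, or lie beyond the last block, where all entries vanish.
  hold-length : ∀ c e → MesonicGlide (0 ∷ 0 ∷ w) (carried c ∷ e ∷ b) → ∃[ d ] JoinLength e c d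
  hold-length c nil G = _ , none
  hold-length c (part black k) G = _ , black
  hold-length (suc c) (part red k) G = _ , red
  hold-length zero (part red k) G with firstNonzero w
  ... | inj₁ w≡0 with () ← vanishing G (suc zero)
          (λ { zero ne → contradiction refl ne ; (suc zero) ne → contradiction refl ne
             ; (suc (suc p)) ne → contradiction (w≡0 p) ne })
  ... | inj₂ (p , ne , h) with leading G (suc (suc p)) ne (suc zero)
          (inBlock-suc⁺ (inBlock-zero⁺ h)) (λ ()) (λ { zero _ _ → refl ; (suc q) _ (s≤s ()) })
  ...   | _ , ()

glide⇒mesonic-carried : ∀ {c} {b : Komposition n} {w} → Glide c b w →
                        MesonicGlide (0 ∷ w) (carried c ∷ b)
glide⇒mesonic-carried done = record
  { vanishing = λ { zero _ → refl }
  ; total     = λ { zero ne → contradiction refl ne }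
  ; leading   = λ { zero ne → contradiction refl ne }
  ; end       = λ { zero ne → contradiction refl ne } }
glide⇒mesonic-carried (hold j g)    = hold-mesonic⁺ j (glide⇒mesonic-carried g)
glide⇒mesonic-carried (emit j ne g) = emit-mesonic⁺ j ne (nil∷-mesonic⁻ (glide⇒mesonic-carried g))

mesonic-carried⇒glide : ∀ c (w : Vec ℕ n) (b : Komposition n) →
                        MesonicGlide (0 ∷ w) (carried c ∷ b) → Glide c b w
mesonic-carried⇒glide zero    [] [] G = done
mesonic-carried⇒glide (suc c) [] [] G
  with () ← MesonicGlide.vanishing G zero (λ { zero ne → contradiction refl ne })
mesonic-carried⇒glide c (zero ∷ w) (e ∷ b) G =
  let (d , j) = hold-length c e G in hold j (mesonic-carried⇒glide d w b (hold-mesonic⁻ j G))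
mesonic-carried⇒glide c (suc x ∷ w) (e ∷ b) G =
  let (j , ne) = emit-length e G in
  emit j ne (mesonic-carried⇒glide 0 w b (nil∷-mesonic⁺ (emit-mesonic⁻ {e = e} {c} G)))

glide⇒mesonic : {b : Komposition n} {w : Vec ℕ n} → Glide 0 b w → MesonicGlide w b
glide⇒mesonic g = nil∷-mesonic⁻ (glide⇒mesonic-carried g)

mesonic⇒glide : {b : Komposition n} {w : Vec ℕ n} → MesonicGlide w b → Glide 0 b w
mesonic⇒glide G = mesonic-carried⇒glide 0 _ _ (nil∷-mesonic⁺ G)

-- Rows of a filling and insertion of a free entry

isMax-unique : ∀ {x y} {S : Subset N} → IsMax x S → IsMax y S → x ≡ y
isMax-unique (x∈ , x≥) (y∈ , y≥) = ≤-antisym (y≥ _ x∈) (x≥ _ y∈)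

module _ {a : Vec ℕ n} where

  adjacent-≢ : {l r : Box a} → Adjacent l r → l ≢ r
  adjacent-≢ (_ , eq) refl = ℕ.1+n≢n (sym eq)

  rowsDecreasing⁻ : {T : Box a → Subset N} → RowsDecreasing T →
    ∀ {l r} → Adjacent l r → ∀ {u v} → u Subset.∈ T l → v Subset.∈ T r → v ≤ u
  rowsDecreasing⁻ D {l} {r} adj {u} {v} u∈ v∈ =
    let (x , X) = min-exists (u , u∈) ; (y , Y) = max-exists (v , v∈) in
    ℕ.≤-trans (proj₂ Y v v∈) (ℕ.≤-trans (D l r adj x y X Y) (proj₂ X u u∈))

  rowsDecreasing⁺ : {T : Box a → Subset N} →
    (∀ {l r} → Adjacent l r → ∀ {u v} → u Subset.∈ T l → v Subset.∈ T r → v ≤ u) → RowsDecreasing T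
  rowsDecreasing⁺ h l r adj x y X Y = h adj (proj₁ X) (proj₁ Y)

  module _ {T : Box a → Subset N} {b : Box a} {x : Fin N} where

    insert-here : insert T b x b ≡ ⁅ x ⁆ ∪ T b
    insert-here = cong (if_then ⁅ x ⁆ ∪ T b else T b) (dec-true (b ≟ᵇ b) refl)

    insert-elsewhere : ∀ {b′} → b ≢ b′ → insert T b x b′ ≡ T b′
    insert-elsewhere {b′} b≢b′ = cong (if_then ⁅ x ⁆ ∪ T b′ else T b′) (dec-false (b ≟ᵇ b′) b≢b′)

    insert⁻ : ∀ {b′ y} → y Subset.∈ insert T b x b′ → (b ≡ b′ × y ≡ x) ⊎ y Subset.∈ T b′
    insert⁻ {b′} y∈ with b ≟ᵇ b′
    ... | no b≢b′ = inj₂ (subst (_ Subset.∈_) (insert-elsewhere b≢b′) y∈)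
    ... | yes refl with x∈p∪q⁻ ⁅ x ⁆ (T b) (subst (_ Subset.∈_) insert-here y∈)
    ...   | inj₁ y∈x = inj₁ (refl , x∈⁅y⁆⇒x≡y x y∈x)
    ...   | inj₂ y∈T = inj₂ y∈T

    insert⁺ : ∀ {b′ y} → y Subset.∈ T b′ → y Subset.∈ insert T b x b′
    insert⁺ {b′} y∈ with b ≟ᵇ b′
    ... | no b≢b′  = subst (_ Subset.∈_) (sym (insert-elsewhere b≢b′)) y∈
    ... | yes refl = subst (_ Subset.∈_) (sym insert-here) (x∈p∪q⁺ (inj₂ y∈))

    insert-new : x Subset.∈ insert T b x b
    insert-new = subst (x Subset.∈_) (sym insert-here) (x∈p∪q⁺ (inj₁ (x∈⁅x⁆ x)))

  Fits : Filling N a → Box a → Fin N → Set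
  Fits F b x = ∀ {r} → Adjacent b r → ∀ {v} → v Subset.∈ F at r → v ≤ x

  insertable⇒fits : ∀ {F : Filling N a} {b x} → RowsDecreasing (insert (F at_) b x) → Fits F b x
  insertable⇒fits {F = F} {b} {x} D adj v∈ =
    rowsDecreasing⁻ D adj (insert-new {T = F at_} {b} {x}) (insert⁺ {T = F at_} {b} {x} v∈)

  -- Only the right neighbor has to be tested: the entries of the left neighbor are at least `m`,
  -- hence above `x`.
  fits⇒insertable : ∀ {F : Filling N a} {b x m} → RowsDecreasing (F at_) →
    m Subset.∈ F at b → x < m → Fits F b x → RowsDecreasing (insert (F at_) b x)
  fits⇒insertable {F = F} {b} {x} {m} D m∈ x<m fits =
    rowsDecreasing⁺ λ adj u∈ v∈ → go adj (insert⁻ {T = F at_} {b} {x} u∈) (insert⁻ {T = F at_} {b} {x} v∈)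
    where
    go : ∀ {l r} → Adjacent l r → ∀ {u v} →
         (b ≡ l × u ≡ x) ⊎ u Subset.∈ F at l → (b ≡ r × v ≡ x) ⊎ v Subset.∈ F at r → v ≤ u
    go adj (inj₁ (refl , _))    (inj₁ (refl , _))    = contradiction refl (adjacent-≢ adj)
    go adj (inj₁ (refl , refl)) (inj₂ v∈)            = fits adj v∈
    go adj (inj₂ u∈)            (inj₁ (refl , refl)) =
      ℕ.≤-trans (ℕ.<⇒≤ x<m) (rowsDecreasing⁻ D adj u∈ m∈)
    go adj (inj₂ u∈)            (inj₂ v∈)            = rowsDecreasing⁻ D adj u∈ v∈

-- Raising preserves and reflects semistandardness

-- Top x z says that the label x of F is raised to z in T.  By spread,
-- raising is strictly increasing on those pairs of entries whose
-- strict inequality matters in (S.1)–(S.5), so F and T satisfy these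
-- conditions simultaneously.
record Raises {a : Vec ℕ n} (F T : Filling N a) (Top : Fin N → Fin N → Set) : Set where
  field
    mono  : ∀ {x y z w} → Top x z → Top y w → x ≤ y → z ≤ w
    above : ∀ {x z} → Top x z → x ≤ z
    idem  : ∀ {x z} → Top x z → Top z z
    raise : ∀ {b x} → x Subset.∈ F at b → ∃[ z ] Top x z × z Subset.∈ T at b
    lower : ∀ {b z} → z Subset.∈ T at b → ∃[ x ] Top x z × x Subset.∈ F at b
    kept  : ∀ {x z} → Top x z → Appears z F
    spread : ∀ {x y z} → x < y → Top x z → Top y z → ∀ {b b′} → x Subset.∈ F at b → y Subset.∈ F at b′ →
            b′ ≡ b ⊎ col b′ ℕ.< col b

  functional : ∀ {x z w} → Top x z → Top x w → z ≡ w
  functional t u = ≤-antisym (mono t u ≤-refl) (mono u t ≤-refl)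

  reflect : ∀ {x y z w} → Top x z → Top y w → z < w → x < y
  reflect t u z<w = ℕ.≰⇒> λ y≤x → ℕ.<⇒≱ z<w (mono u t y≤x)

  same-column : ∀ {x y z b b′} → x < y → Top x z → Top y z → x Subset.∈ F at b → y Subset.∈ F at b′ →
                col b ≡ col b′ → b′ ≡ b
  same-column x<y t u x∈ y∈ eq with spread x<y t u x∈ y∈
  ... | inj₁ p = p
  ... | inj₂ p = contradiction (sym eq) (ℕ.<⇒≢ p)

  not-right : ∀ {x y z b b′} → x < y → Top x z → Top y z → x Subset.∈ F at b → y Subset.∈ F at b′ →
              ¬ col b ℕ.< col b′
  not-right x<y t u x∈ y∈ lt with spread x<y t u x∈ y∈
  ... | inj₁ refl = ℕ.<-irrefl refl lt
  ... | inj₂ p    = ℕ.<-asym p lt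

  strict : ∀ {x y z w b b′} → x < y → Top x z → Top y w → x Subset.∈ F at b → y Subset.∈ F at b′ →
           col b ≡ col b′ → b′ ≢ b → z < w
  strict x<y t u x∈ y∈ eq ne = ≤∧≢⇒< (mono t u (ℕ.<⇒≤ x<y))
    λ { refl → ne (same-column x<y t u x∈ y∈ eq) }

  -- If `y < x`, monotonicity would force `z ≡ w`, and then `spread` forbids the larger label `x` to
  -- stand strictly right of `y`.
  no-inversion : ∀ {x y z w b b′} → z ≤ w → Top x z → Top y w → x Subset.∈ F at b → y Subset.∈ F at b′ →
                 col b′ ℕ.< col b → x ≤ y
  no-inversion z≤w t u x∈ y∈ lt = ℕ.≮⇒≥ λ y<x →
    not-right y<x u (subst (Top _) (≤-antisym z≤w (mono u t (ℕ.<⇒≤ y<x))) t) y∈ x∈ lt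

  anchor⁺ : ∀ {b x z} → Top x z → IsMax x (F at b) → IsMax z (T at b)
  anchor⁺ {b} t (x∈ , x≥) = let (_ , t′ , z∈) = raise x∈ in
    subst (Subset._∈ T at b) (functional t′ t) z∈ ,
    λ w w∈ → let (y , u , y∈) = lower w∈ in mono u t (x≥ y y∈)

  -- A preimage given by `lower` need not be the maximum of its box. So the maximum of `F at b` is
  -- raised instead, and uniqueness of maxima identifies the result with `z`.
  anchor⁻ : ∀ {b z} → IsMax z (T at b) → ∃[ x ] Top x z × IsMax x (F at b)
  anchor⁻ {b} Z = let (x , _ , x∈) = lower (proj₁ Z) ; (y , Y) = max-exists (x , x∈)
                      (w , t , _) = raise (proj₁ Y) in
    y , subst (Top y) (isMax-unique (anchor⁺ t Y) Z) t , Y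

  -- By `kept`, the target `z` occurs in `F`. Were `x < z`, `spread` would put `z` into `b`, whose
  -- maximum is `x`, or to the left of the first column.
  first-column-fixed : ∀ {b x z} → col b ≡ 0 → Top x z → IsMax x (F at b) → toℕ x ≡ toℕ z
  first-column-fixed {b} {x} {z} eq t X with ℕ.m≤n⇒m<n∨m≡n (above t)
  ... | inj₂ x≡z = x≡z
  ... | inj₁ x<z with kept t
  ...   | b′ , z∈ with spread x<z t (idem t) (proj₁ X) z∈
  ...     | inj₁ refl = contradiction (proj₂ X z z∈) (ℕ.<⇒≱ x<z)
  ...     | inj₂ lt   = contradiction (subst (col b′ ℕ.<_) eq lt) λ ()

  module _ (S : Semistandard F) where
    open Semistandard S

    coarse-rows : RowsDecreasing (T at_)
    coarse-rows = rowsDecreasing⁺ λ adj u∈ v∈ →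
      let (_ , t , x∈) = lower u∈ ; (_ , s , y∈) = lower v∈ in
      mono s t (rowsDecreasing⁻ rowsDecreasing adj x∈ y∈)

    coarse-distinct : ColumnsDistinct T
    coarse-distinct b b′ z eq z∈ z∈′ with lower z∈ | lower z∈′
    ... | x , t , x∈ | y , u , y∈ with <-cmp x y
    ...   | tri< x<y _ _    = sym (same-column x<y t u x∈ y∈ eq)
    ...   | tri≈ _ refl _   = columnsDistinct b b′ x eq x∈ y∈
    ...   | tri> _ _ y<x    = same-column y<x u t y∈ x∈ (sym eq)

    -- Only the strict inequality of an inversion triple can collapse. Its entries lie in different
    -- boxes of one column, or the larger one lies in the next column to the right; labels of one
    -- block stand in neither position.
    coarse-inversions : AnchorsInverted T
    coarse-inversions l r t triple α β γ A B C with anchor⁻ A | anchor⁻ B | anchor⁻ C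
    ... | α′ , s , A′ | β′ , u , B′ | γ′ , v , C′
      with triple | anchorsInverted l r t triple α′ β′ γ′ A′ B′ C′
    ... | (_ , lr) , inj₁ (r<t , tr , _) | inj₁ (γ<α , α≤β) =
      inj₁ (strict γ<α v s (proj₁ C′) (proj₁ A′) tr (λ { refl → ℕ.<-irrefl refl r<t }) , mono s u α≤β)
    ... | (_ , lr) , inj₂ (t<l , tl , _) | inj₁ (γ<α , α≤β) =
      inj₁ (≤∧≢⇒< (mono v s (ℕ.<⇒≤ γ<α)) (λ { refl → not-right γ<α v s (proj₁ C′) (proj₁ A′)
             (ℕ.≤-reflexive (trans (cong suc tl) (sym lr))) }) , mono s u α≤β)
    ... | (_ , lr) , inj₁ (r<t , tr , _) | inj₂ (α≤β , β<γ) =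
      inj₂ (mono s u α≤β , ≤∧≢⇒< (mono u v (ℕ.<⇒≤ β<γ)) λ { refl → not-right β<γ u v (proj₁ B′) (proj₁ C′)
             (ℕ.≤-reflexive (trans (sym lr) (sym tr))) })
    ... | (_ , lr) , inj₂ (t<l , tl , _) | inj₂ (α≤β , β<γ) =
      inj₂ (mono s u α≤β , strict β<γ u v (proj₁ B′) (proj₁ C′) (sym tl) λ { refl → ℕ.<-irrefl refl t<l })

    -- If `z` fitted into `b′` in `T`, its preimage `x` would fit there in `F`: the entries to be
    -- compared with it lie one column further right, where `no-inversion` applies.
    coarse-free : FreeLeast T
    coarse-free b b′ eq z m m′ (z∈ , _) M M′ z<m′ m′<m D
      with lower z∈ | anchor⁻ M | anchor⁻ M′
    ... | x , t , x∈ | μ , u , U | μ′ , u′ , U′ =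
      freeLeast b b′ eq x μ μ′
        (x∈ , λ X → ℕ.<⇒≱ (<-trans x<μ′ μ′<μ) (proj₂ X μ (proj₁ U))) U U′ x<μ′ μ′<μ
        (fits⇒insertable {F = F} rowsDecreasing (proj₁ U′) x<μ′ fits)
      where
      x<μ′ = reflect t u′ z<m′
      μ′<μ = reflect u′ u m′<m
      fits : Fits F b′ x
      fits adj@(_ , br) v∈ = let (w , s , w∈) = raise v∈ in
        no-inversion (insertable⇒fits {F = T} D adj w∈) s t v∈ x∈
          (ℕ.≤-reflexive (trans (cong suc eq) (sym br)))

    coarse-first : FirstColumnAnchored T
    coarse-first b eq z Z = let (x , t , X) = anchor⁻ Z in
      trans (sym (first-column-fixed eq t X)) (firstColumn b eq x X)

    coarse : Semistandard T
    coarse = record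
      { nonempty        = λ b → let (x , x∈) = nonempty b ; (z , _ , z∈) = raise x∈ in z , z∈
      ; columnsDistinct = coarse-distinct
      ; rowsDecreasing  = coarse-rows
      ; anchorsInverted = coarse-inversions
      ; freeLeast       = coarse-free
      ; firstColumn     = coarse-first }

  module _ (S : Semistandard T) where
    open Semistandard S

    fine-nonempty : ∀ b → Nonempty (F at b)
    fine-nonempty b = let (z , z∈) = nonempty b ; (x , _ , x∈) = lower z∈ in x , x∈

    fine-rows : RowsDecreasing (F at_)
    fine-rows = rowsDecreasing⁺ λ adj u∈ v∈ →
      let (_ , t , z∈) = raise u∈ ; (_ , s , w∈) = raise v∈ in
      no-inversion (rowsDecreasing⁻ rowsDecreasing adj z∈ w∈) s t v∈ u∈
        (ℕ.≤-reflexive (sym (proj₂ adj)))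

    fine-distinct : ColumnsDistinct F
    fine-distinct b b′ x eq x∈ x∈′ =
      let (z , t , z∈) = raise x∈ ; (w , u , w∈) = raise x∈′ in
      columnsDistinct b b′ z eq z∈ (subst (Subset._∈ T at b′) (functional u t) w∈)

    -- Raised labels determine only strict inequalities of the original ones, so the weak inequality
    -- is taken from the rows of `F`.
    fine-inversions : AnchorsInverted F
    fine-inversions l r t triple@(adj , _) α β γ A B C
      with raise (proj₁ A) | raise (proj₁ B) | raise (proj₁ C)
    ... | _ , s , _ | _ , u , _ | _ , v , _
      with anchorsInverted l r t triple _ _ _ (anchor⁺ s A) (anchor⁺ u B) (anchor⁺ v C)
    ... | inj₁ (γ<α , _) = inj₁ (reflect v s γ<α , rowsDecreasing⁻ fine-rows adj (proj₁ B) (proj₁ A))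
    ... | inj₂ (_ , β<γ) = inj₂ (rowsDecreasing⁻ fine-rows adj (proj₁ B) (proj₁ A) , reflect u v β<γ)

    fine-free : FreeLeast F
    fine-free b b′ eq x μ μ′ (x∈ , ¬X) U U′ x<μ′ μ′<μ D
      with raise x∈ | raise (proj₁ U) | raise (proj₁ U′)
    ... | z , t , z∈ | m , u , _ | m′ , u′ , _ =
      freeLeast b b′ eq z m m′ (z∈ , λ Z → ℕ.<⇒≱ (<-trans z<m′ m′<m) (proj₂ Z m (proj₁ M)))
        M (anchor⁺ u′ U′) z<m′ m′<m
        (fits⇒insertable {F = T} rowsDecreasing (proj₁ (anchor⁺ u′ U′)) z<m′ fits)
      where
      M = anchor⁺ u U
      b≢b′ : b ≢ b′
      b≢b′ refl = <-irrefl (isMax-unique U′ U) μ′<μ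
      -- Both comparisons are between different boxes of one column, so their strictness survives
      -- raising.
      z<m′ = strict x<μ′ t u′ x∈ (proj₁ U′) eq (b≢b′ ∘ sym)
      m′<m = strict μ′<μ u′ u (proj₁ U′) (proj₁ U) (sym eq) b≢b′
      fits : Fits T b′ z
      fits adj w∈ = let (_ , s , v∈) = lower w∈ in mono s t (insertable⇒fits {F = F} D adj v∈)

    fine-first : FirstColumnAnchored F
    fine-first b eq x X = let (z , t , _) = raise (proj₁ X) in
      trans (first-column-fixed eq t X) (firstColumn b eq z (anchor⁺ t X))

    fine : Semistandard F
    fine = record
      { nonempty        = fine-nonempty
      ; columnsDistinct = fine-distinct
      ; rowsDecreasing  = fine-rows
      ; anchorsInverted = fine-inversions
      ; freeLeast       = fine-free
      ; firstColumn     = fine-first }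

-- Counting lemmas and the list of boxes

concatMap-unique : {f : A → List B} → ∀ {xs} → Unique xs → (∀ x → Unique (f x)) →
  (∀ {x y z} → z ∈ f x → z ∈ f y → x ≡ y) → Unique (concatMap f xs)
concatMap-unique {xs = []} _ _ _ = []
concatMap-unique {f = f} {x ∷ xs} (h ∷ u) uf inj =
  Unique.++⁺ (uf x) (concatMap-unique u uf inj) λ (z∈ , z∈′) → disjoint xs h z∈ z∈′
  where
  disjoint : ∀ {z} xs → LAll.All (x ≢_) xs → z ∈ f x → ¬ z ∈ concatMap f xs
  disjoint (y ∷ xs) (x≢y ∷ h) z∈ z∈′ with ∈-++⁻ (f y) z∈′
  ... | inj₁ z∈y = x≢y (inj z∈ z∈y)
  ... | inj₂ z∈s = disjoint xs h z∈ z∈s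

length-concatMap : (f : A → List B) → ∀ xs → length (concatMap f xs) ≡ List.foldr (λ x s → length (f x) + s) 0 xs
length-concatMap f []       = refl
length-concatMap f (x ∷ xs) = trans (List.length-++ (f x)) (cong (length (f x) +_) (length-concatMap f xs))

sum-tabulate-≤ : {f g : Fin n → ℕ} → (∀ i → f i ℕ.≤ g i) → Vec.sum (tabulate f) ℕ.≤ Vec.sum (tabulate g)
sum-tabulate-≤ {zero}  h = z≤n
sum-tabulate-≤ {suc n} h = ℕ.+-mono-≤ (h zero) (sum-tabulate-≤ (h ∘ suc))

sum-tabulate-< : {f g : Fin n → ℕ} → (∀ i → f i ℕ.≤ g i) → (∃[ i ] f i ℕ.< g i) →
                 Vec.sum (tabulate f) ℕ.< Vec.sum (tabulate g)
sum-tabulate-< h (zero  , lt) = ℕ.+-mono-<-≤ lt (sum-tabulate-≤ (h ∘ suc))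
sum-tabulate-< h (suc i , lt) = ℕ.+-mono-≤-< (h zero) (sum-tabulate-< (h ∘ suc) (i , lt))

-- Every element is counted by at least one filter. For boxes and labels this bounds the weight from
-- below by the number of boxes, so that `∸` does not truncate.
length≤sum-filters : {P : Fin n → A → Set} (P? : ∀ i x → Dec (P i x)) → (∀ x → ∃[ i ] P i x) →
  ∀ xs → length xs ℕ.≤ Vec.sum (tabulate λ i → length (filter (P? i) xs))
length≤sum-filters P? total []       = z≤n
length≤sum-filters P? total (x ∷ xs) = ℕ.≤-<-trans (length≤sum-filters P? total xs)
  (sum-tabulate-< mono (let (i , p) = total x in i ,
    ℕ.≤-reflexive (sym (cong length (List.filter-accept (P? i) p)))))
  where
  mono : ∀ i → length (filter (P? i) xs) ℕ.≤ length (filter (P? i) (x ∷ xs))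
  mono i with P? i x
  ... | yes _ = ℕ.n≤1+n _
  ... | no  _ = ℕ.≤-refl

least : {P : Fin n → Set} → (∀ i → Dec (P i)) → ∃ P → ∃[ i ] P i × (∀ k → k < i → ¬ P k)
least {suc n} P? (i , p) with P? zero
... | yes p₀ = zero , p₀ , λ _ ()
least {suc n} P? (zero  , p) | no ¬p₀ = contradiction p ¬p₀
least {suc n} P? (suc i , p) | no ¬p₀ =
  let (k , q , h) = least (P? ∘ suc) (i , p) in
  suc k , q , λ { zero _ → ¬p₀ ; (suc j) (s≤s j<k) → h j j<k }

module _ (a : Vec ℕ n) where

  ∈-boxes : (b : Box a) → b ∈ boxes a
  ∈-boxes ⟨ i , j ⟩ = ∈-concat⁺′ (∈-map⁺ ⟨ i ,_⟩ (∈-allFin j)) (∈-map⁺ _ (∈-allFin i))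

  boxes-unique : Unique (boxes a)
  boxes-unique = concatMap-unique (Unique.allFin⁺ n)
    (λ i → Unique.map⁺ (λ { refl → refl }) (Unique.allFin⁺ (lookup a i)))
    (λ z∈ z∈′ → trans (sym (row-of z∈)) (row-of z∈′))
    where
    row-of : ∀ {i} {z : Box a} → z ∈ List.map ⟨ i ,_⟩ (allFin (lookup a i)) → row z ≡ i
    row-of z∈ with ∈-map⁻ _ z∈
    ... | _ , _ , refl = refl

  length-boxes : length (boxes a) ≡ ∣ a ∣
  length-boxes = trans (length-concatMap row-boxes (allFin n)) (trans (rows (allFin n)) (sums a))
    where
    row-boxes : (i : Fin n) → List (Box a)
    row-boxes i = List.map ⟨ i ,_⟩ (allFin (lookup a i))
    total : ∀ {m} → (Fin m → ℕ) → List (Fin m) → ℕ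
    total f = List.foldr (λ i s → f i + s) 0
    rows : ∀ is → total (length ∘ row-boxes) is ≡ total (lookup a) is
    rows []       = refl
    rows (i ∷ is) = cong₂ _+_
      (trans (List.length-map (⟨_,_⟩ {a = a} i) (allFin (lookup a i))) (List.length-tabulate {n = lookup a i} (λ k → k)))
      (rows is)
    total-suc : ∀ {m} x (a : Vec ℕ m) is → total (lookup (x ∷ a)) (List.map suc is) ≡ total (lookup a) is
    total-suc x a []       = refl
    total-suc x a (i ∷ is) = cong (lookup a i +_) (total-suc x a is)
    sums : ∀ {m} (a : Vec ℕ m) → total (lookup a) (allFin m) ≡ Vec.sum a
    sums [] = refl
    sums {suc m} (x ∷ a) = cong (x +_) (trans
      (cong (total (lookup (x ∷ a))) (sym (List.map-tabulate {n = m} (λ k → k) suc)))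
      (trans (total-suc x a (allFin m)) (sums a)))

  -- The list `boxes` runs row by row; sorted by column, it yields lists of occurrences that read
  -- from left to right.
  columnwise : List (Box a)
  columnwise = Sort.sort (On.decTotalOrder ℕ.≤-decTotalOrder col) (boxes a)

  columnwise-↭ : columnwise ↭ boxes a
  columnwise-↭ = Sort.sort-↭ (On.decTotalOrder ℕ.≤-decTotalOrder col) (boxes a)

  columnwise-unique : Unique columnwise
  columnwise-unique = ↭ₛ.Unique-resp-↭ (setoid (Box a)) (↭⇒↭ₛ (↭-sym columnwise-↭)) boxes-unique

  columnwise-sorted : AllPairs (λ b b′ → col b ℕ.≤ col b′) columnwise
  columnwise-sorted = Sorted.Sorted⇒AllPairs (On.totalOrder ℕ.≤-totalOrder col)
    (Sort.sort-↗ (On.decTotalOrder ℕ.≤-decTotalOrder col) (boxes a))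

-- Fillings as vectors of ascending lists

filling-ext : {a : Vec ℕ n} {F G : Filling N a} → (∀ b → F at b ≡ G at b) → F ≡ G
filling-ext {F = []}    {[]}    h = refl
filling-ext {F = R ∷ F} {S ∷ G} h = cong₂ _∷_
  (trans (sym (Vec.tabulate∘lookup R)) (trans (Vec.tabulate-cong (λ j → h ⟨ zero , j ⟩)) (Vec.tabulate∘lookup S)))
  (filling-ext λ (⟨ i , j ⟩) → h ⟨ suc i , j ⟩)

lookup⁺-lookup⁻ : ∀ {P : A → Set} {xs : Vec A n} (f : ∀ i → P (lookup xs i)) i →
                  lookup⁺ {P = P} {xs = xs} (lookup⁻ f) i ≡ f i
lookup⁺-lookup⁻ {xs = _ ∷ _} f zero    = refl
lookup⁺-lookup⁻ {P = P} {xs = _ ∷ xs} f (suc i) = lookup⁺-lookup⁻ {P = P} {xs = xs} (f ∘ suc) i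

module _ {a : Vec ℕ n} where

  open Splitting {Box a} col _≟ᵇ_
  open DecMembership {A = Box a} _≟ᵇ_ using () renaming (_∈?_ to _∈ᵇ?_)

  fill : (Box a → Subset N) → Filling N a
  fill S = lookup⁻ λ i → tabulate λ j → S ⟨ i , j ⟩

  fill-at : (S : Box a → Subset N) → ∀ b → fill S at b ≡ S b
  fill-at S ⟨ i , j ⟩ = trans
    (cong (λ R → lookup R j) (lookup⁺-lookup⁻ {xs = a} (λ i → tabulate λ j → S ⟨ i , j ⟩) i))
    (Vec.lookup∘tabulate (λ j → S ⟨ i , j ⟩) j)

  occurrences : Filling N a → Vec (List (Box a)) N
  occurrences F = tabulate λ x → filter (λ b → x ∈? F at b) (columnwise a)

  module _ (F : Filling N a) {x : Fin N} where

    private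
      lookup-occ : lookup (occurrences F) x ≡ filter (λ b → x ∈? F at b) (columnwise a)
      lookup-occ = Vec.lookup∘tabulate (λ x → filter (λ b → x ∈? F at b) (columnwise a)) x

    ∈-occurrences⁺ : ∀ {b} → x Subset.∈ F at b → b ∈ lookup (occurrences F) x
    ∈-occurrences⁺ {b} x∈ = subst (b ∈_) (sym lookup-occ)
      (∈-filter⁺ (λ b → x ∈? F at b) (↭.∈-resp-↭ (↭-sym (columnwise-↭ a)) (∈-boxes a b)) x∈)

    ∈-occurrences⁻ : ∀ {b} → b ∈ lookup (occurrences F) x → x Subset.∈ F at b
    ∈-occurrences⁻ {b} b∈ = proj₂
      (∈-filter⁻ (λ b → x ∈? F at b) {xs = columnwise a} (subst (b ∈_) lookup-occ b∈))

    occurs⁺ : Appears x F → lookup (occurrences F) x ≢ []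
    occurs⁺ (b , x∈) eq with () ← subst (b ∈_) eq (∈-occurrences⁺ x∈)

    occurs⁻ : lookup (occurrences F) x ≢ [] → Appears x F
    occurs⁻ ne = go _ refl ne
      where
      go : ∀ l → lookup (occurrences F) x ≡ l → l ≢ [] → Appears x F
      go []      _  ne = contradiction refl ne
      go (b ∷ l) eq _  = b , ∈-occurrences⁻ (subst (b ∈_) (sym eq) (here refl))

    -- Sorting makes the columns weakly increasing, and (S.1) keeps two boxes with the same label
    -- out of one column.
    occurrence-ascending : ColumnsDistinct F → Ascending (lookup (occurrences F) x)
    occurrence-ascending D = subst Ascending (sym lookup-occ)
      (strict (filter-sorted)
        (Unique.filter⁺ P? (columnwise-unique a))
        (λ b∈ → proj₂ (∈-filter⁻ P? {xs = columnwise a} b∈)))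
      where
      P? = λ b → x ∈? F at b
      filter-sorted : AllPairs (λ b b′ → col b ℕ.≤ col b′) (filter P? (columnwise a))
      filter-sorted = AllPairs.filter⁺ P? (columnwise-sorted a)
      strict : ∀ {bs} → AllPairs (λ b b′ → col b ℕ.≤ col b′) bs → Unique bs →
               (∀ {b} → b ∈ bs → x Subset.∈ F at b) → Ascending bs
      strict [] [] _ = []
      strict (le ∷ s) (ne ∷ u) h = LAll.tabulate (λ b∈ → ℕ.≤∧≢⇒< (LAll.lookup le b∈)
        λ eq → LAll.lookup ne b∈ (D _ _ x eq (h (here refl)) (h (there b∈)))) ∷ strict s u (h ∘ there)

  occurrences-ascending : (F : Filling N a) → ColumnsDistinct F → All Ascending (occurrences F)
  occurrences-ascending F D = lookup⁻ λ x → occurrence-ascending F D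

  occurrences-length : (F : Filling N a) → Vec.map length (occurrences F) ≡ wt F
  occurrences-length F = trans (sym (Vec.tabulate-∘ length (λ x → filter (λ b → x ∈? F at b) (columnwise a))))
    (Vec.tabulate-cong λ x → ↭.↭-length (↭.filter-↭ (λ b → x ∈? F at b) (columnwise-↭ a)))

  occurrences-injective : (F G : Filling N a) → occurrences F ≡ occurrences G → F ≡ G
  occurrences-injective F G eq = filling-ext λ b → ⊆-antisym
    (λ {x} x∈ → ∈-occurrences⁻ G (subst (λ L → b ∈ lookup L x) eq (∈-occurrences⁺ F x∈)))
    (λ {x} x∈ → ∈-occurrences⁻ F (subst (λ L → b ∈ lookup L x) (sym eq) (∈-occurrences⁺ G x∈)))

  assemble : Vec (List (Box a)) N → Filling N a
  assemble L = fill λ b → tabulate λ x → does (b ∈ᵇ? lookup L x)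

  module _ (L : Vec (List (Box a)) N) {x : Fin N} {b : Box a} where

    private
      bit : lookup (assemble L at b) x ≡ does (b ∈ᵇ? lookup L x)
      bit = trans (cong (λ S → lookup S x) (fill-at (λ b → tabulate λ x → does (b ∈ᵇ? lookup L x)) b))
                  (Vec.lookup∘tabulate (λ x → does (b ∈ᵇ? lookup L x)) x)

    ∈-assemble⁺ : b ∈ lookup L x → x Subset.∈ assemble L at b
    ∈-assemble⁺ b∈ = Vec.lookup⇒[]= x _ (trans bit (dec-true (b ∈ᵇ? lookup L x) b∈))

    ∈-assemble⁻ : x Subset.∈ assemble L at b → b ∈ lookup L x
    ∈-assemble⁻ x∈ = holds (b ∈ᵇ? lookup L x) (trans (sym bit) (Vec.[]=⇒lookup x∈))
      where
      holds : ∀ {P : Set} (P? : Dec P) → does P? ≡ true → P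
      holds (yes p) _ = p

  ascending-col-injective : ∀ {l : List (Box a)} {b b′} → Ascending l → b ∈ l → b′ ∈ l → col b ≡ col b′ → b ≡ b′
  ascending-col-injective (h ∷ _) (here refl) (here refl) _  = refl
  ascending-col-injective (h ∷ _) (here refl) (there b∈′) eq = contradiction eq (ℕ.<⇒≢ (LAll.lookup h b∈′))
  ascending-col-injective (h ∷ _) (there b∈) (here refl)  eq = contradiction (sym eq) (ℕ.<⇒≢ (LAll.lookup h b∈))
  ascending-col-injective (_ ∷ s) (there b∈) (there b∈′)  eq = ascending-col-injective s b∈ b∈′ eq

  module _ {L : Vec (List (Box a)) N} (asc : All Ascending L) where

    assemble-distinct : ColumnsDistinct (assemble L)
    assemble-distinct b b′ x eq x∈ x∈′ =
      ascending-col-injective (lookup⁺ asc x) (∈-assemble⁻ L x∈) (∈-assemble⁻ L x∈′) eq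

    occurrences-assemble : occurrences (assemble L) ≡ L
    occurrences-assemble = trans (sym (Vec.tabulate∘lookup _)) (trans (Vec.tabulate-cong λ x →
      asc-ext (occurrence-ascending (assemble L) assemble-distinct) (lookup⁺ asc x)
        (λ b∈ → ∈-assemble⁻ L (∈-occurrences⁻ (assemble L) b∈))
        (λ b∈ → ∈-occurrences⁺ (assemble L) (∈-assemble⁺ L b∈)))
      (Vec.tabulate∘lookup L))

  coarsens⇒raises : (F T : Filling N a) {b : Komposition N} →
    Coarsens [] (occurrences F) b (occurrences T) → All Ascending (occurrences T) →
    Raises F T (Top (occurrences T))
  coarsens⇒raises F T r asc = record
    { mono   = top-mono
    ; above  = x≤top
    ; idem   = top-idem
    ; raise  = λ {b} {x} x∈ → let (z , t , b∈) = raise r x (∈-occurrences⁺ F x∈) in z , t , ∈-occurrences⁻ T b∈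
    ; lower  = λ {b} {z} z∈ → lower′ (lower r z (∈-occurrences⁺ T z∈))
    ; kept   = λ {x} {z} t → occurs⁻ F (lookup-≢[] r z (top⇒≢[] t))
    ; spread = λ x<y t u x∈ y∈ → block-⊲ r asc x<y t u (∈-occurrences⁺ F y∈) (∈-occurrences⁺ F x∈)
    }
    where
    lower′ : ∀ {b z} →
      (FirstAt (occurrences T) z × b ∈ []) ⊎ (∃[ x ] Top (occurrences T) x z × b ∈ lookup (occurrences F) x) →
      ∃[ x ] Top (occurrences T) x z × x Subset.∈ F at b
    lower′ (inj₂ (x , t , b∈)) = x , t , ∈-occurrences⁻ F b∈

  -- `Tight` is recursive to suit the scan. This lemma and `tight⁺` translate it into a statement
  -- about consecutive occurring labels, the form in which it meets `MesonHighest`.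
  tight⁻ : ∀ {T : Vec (List (Box a)) N} → Tight T → ∀ i k → i < k →
    lookup T i ≢ [] → lookup T k ≢ [] → (∀ j → i < j → j < k → lookup T j ≡ []) →
    ¬ lookup T k ⊲ lookup T i
  tight⁻ {T = t ∷ T} (h , _) zero (suc k) _ ne ne′ between =
    h ne _ (first-lookup T k ne′ λ j j<k → between (suc j) (s≤s z≤n) (s≤s j<k))
    where
    first-lookup : ∀ {m} (T : Vec (List (Box a)) m) k → lookup T k ≢ [] →
                   (∀ j → j < k → lookup T j ≡ []) → First (lookup T k) T
    first-lookup (t ∷ T) zero    ne h = here ne
    first-lookup (t ∷ T) (suc k) ne h with refl ← h zero (s≤s z≤n) =
      there (first-lookup T k ne λ j j<k → h (suc j) (s≤s j<k))
  tight⁻ {T = t ∷ T} (_ , tight) (suc i) (suc k) (s≤s i<k) ne ne′ between =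
    tight⁻ tight i k i<k ne ne′ λ j i<j j<k → between (suc j) (s≤s i<j) (s≤s j<k)

  tight⁺ : ∀ {T : Vec (List (Box a)) N} →
    (∀ i k → i < k → lookup T i ≢ [] → lookup T k ≢ [] →
      (∀ j → i < j → j < k → lookup T j ≡ []) → ¬ lookup T k ⊲ lookup T i) →
    Tight T
  tight⁺ {T = []} h = _
  tight⁺ {T = t ∷ T} h =
    (λ ne s f → let (k , ne′ , below , eq) = lookup-first f in
      subst (λ s → ¬ s ⊲ t) eq
        (h zero (suc k) (s≤s z≤n) ne ne′ λ { (suc j) _ (s≤s j<k) → below j j<k })) ,
    tight⁺ λ i k i<k ne ne′ between → h (suc i) (suc k) (s≤s i<k) ne ne′
      λ { (suc j) (s≤s i<j) (s≤s j<k) → between j i<j j<k }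
    where
    lookup-first : ∀ {m s} {T : Vec (List (Box a)) m} → First s T →
      ∃[ k ] lookup T k ≢ [] × (∀ j → j < k → lookup T j ≡ []) × lookup T k ≡ s
    lookup-first (here ne) = zero , ne , (λ _ ()) , refl
    lookup-first (there f) = let (k , ne , below , eq) = lookup-first f in
      suc k , ne , (λ { zero _ → refl ; (suc j) (s≤s j<k) → below j j<k }) , eq

  ascending-leftmost : ∀ {l : List (Box a)} → Ascending l → l ≢ [] →
                       ∃[ b ] b ∈ l × (∀ {b′} → b′ ∈ l → col b ℕ.≤ col b′)
  ascending-leftmost [] ne = contradiction refl ne
  ascending-leftmost (h ∷ _) _ = _ , here refl ,
    λ { (here refl) → ℕ.≤-refl ; (there b∈) → ℕ.<⇒≤ (LAll.lookup h b∈) }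

  absent : (F : Filling N a) {x : Fin N} → ¬ Appears x F → lookup (occurrences F) x ≡ []
  absent F {x} ∄ = go _ refl
    where
    go : ∀ l → lookup (occurrences F) x ≡ l → lookup (occurrences F) x ≡ []
    go []      eq = eq
    go (b ∷ l) eq = contradiction (b , ∈-occurrences⁻ F (subst (b ∈_) (sym eq) (here refl))) ∄

-- Meson-highest fillings are the tight ones

module _ {a : Vec ℕ n} {F : Filling n a} (S : Semistandard F) where

  open Splitting {Box a} col _≟ᵇ_
  open Semistandard S

  -- If the next label `k` could be merged with `i`, each of its boxes would be the leftmost box `b`
  -- of `i` or strictly left of it. Were `b` in the first column with anchor `i`, the larger `k`
  -- would have to be in `b`; the other clause supplies a box of `k` other than `b` and weakly right
  -- of it.
  mesonHighest⇒tight : MesonHighest F → Tight (occurrences F)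
  mesonHighest⇒tight M = tight⁺ λ i k i<k ne ne′ between k⊲i →
    let (b , b∈ , leftmost) = ascending-leftmost (occurrence-ascending F columnsDistinct) ne in
    go i<k (occurs⁻ F ne′) between k⊲i b∈
      (M i b (∈-occurrences⁻ F b∈ , λ b′ i∈ → leftmost (∈-occurrences⁺ F i∈)))
    where
    go : ∀ {i k b} → i < k → Appears k F →
         (∀ j → i < j → j < k → lookup (occurrences F) j ≡ []) →
         lookup (occurrences F) k ⊲ lookup (occurrences F) i → b ∈ lookup (occurrences F) i →
         ¬ ((col b ≡ 0 × IsAnchor i (F at b)) ⊎
            (∃[ y ] Next F i y × ∃[ b′ ] y Subset.∈ F at b′ × col b ℕ.≤ col b′ × b ≢ b′))
    go {b = b} i<k (b′ , k∈) between k⊲i b∈ (inj₁ (eq , _ , anchor)) with k⊲i {b′} {b} (∈-occurrences⁺ F k∈) b∈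
    ... | inj₁ refl = ℕ.<⇒≱ i<k (anchor _ k∈)
    ... | inj₂ lt with () ← subst (col b′ ℕ.<_) eq lt
    -- The label `y` of `Next` is `k`: it is at most `k` by minimality, and by `between` no label
    -- strictly between `i` and `k` occurs.
    go {k = k} {b} i<k App between k⊲i b∈ (inj₂ (y , (i<y , y∈F , minimal) , b′ , y∈ , le , ne))
      with ℕ.m≤n⇒m<n∨m≡n (minimal k i<k App)
    ... | inj₁ y<k = contradiction (between y i<y y<k) (occurs⁺ F y∈F)
    ... | inj₂ eq with refl ← toℕ-injective eq with k⊲i {b′} {b} (∈-occurrences⁺ F y∈) b∈
    ...   | inj₁ refl = ne refl
    ...   | inj₂ lt   = ℕ.<⇒≱ lt le

  -- The largest occurring label `x` is the anchor of the first box of a row containing it: that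
  -- anchor is the row index, which is at least `x` by `entry≤row`. For any other `x`, failure of
  -- the second clause puts every `y` in `b` or strictly left of it, hence makes the lists
  -- mergeable.
  tight⇒mesonHighest : Tight (occurrences F) → MesonHighest F
  tight⇒mesonHighest tight x b@(⟨ i , j ⟩) (x∈ , leftmost)
    with any? (λ z → (x <? z) ×-dec appears? z F)
  ... | no ∄z = inj₁ (col≡0 , subst (λ b → IsAnchor x (F at b))
                  (sym (columnsDistinct b b₀ x (trans col≡0 (sym col₀)) x∈ (proj₁ x-anchor))) x-anchor)
    where
    first₀ : ∀ {k} → Fin k → ∃[ j ] toℕ {k} j ≡ 0
    first₀ zero    = zero , refl
    first₀ (suc _) = zero , refl
    b₀ : Box a
    b₀ = ⟨ i , proj₁ (first₀ j) ⟩
    col₀ : col b₀ ≡ 0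
    col₀ = proj₂ (first₀ j)
    x-anchor : IsAnchor x (F at b₀)
    x-anchor = let (m , M) = max-exists (nonempty b₀) in
      subst (λ x → IsMax x (F at b₀)) (≤-antisym
        (ℕ.≮⇒≥ λ x<m → ∄z (m , x<m , b₀ , proj₁ M))
        (ℕ.≤-trans (entry≤row S b x x∈) (ℕ.≤-reflexive (sym (firstColumn b₀ col₀ m M))))) M
    col≡0 : col b ≡ 0
    col≡0 = ℕ.n≤0⇒n≡0 (ℕ.≤-trans (leftmost b₀ (proj₁ x-anchor)) (ℕ.≤-reflexive col₀))
  ... | yes e with least (λ z → (x <? z) ×-dec appears? z F) e
  ...   | y , (x<y , App) , minimal
    with anyBox? (λ b′ → (y ∈? F at b′) ×-dec (col b ℕ.≤? col b′) ×-dec ¬? (b ≟ᵇ b′))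
  ...   | yes (b′ , y∈ , le , ne) = inj₂ (y , next , b′ , y∈ , le , ne)
    where
    next : Next F x y
    next = x<y , App , λ z x<z z∈ → ℕ.≮⇒≥ λ z<y → minimal z z<y (x<z , z∈)
  ...   | no ∄b = ⊥-elim (tight⁻ tight x y x<y (occurs⁺ F (b , x∈)) (occurs⁺ F App)
      (λ z x<z z<y → absent F λ z∈ → minimal z z<y (x<z , z∈)) y⊲x)
    where
    below : ∀ {b′} → y Subset.∈ F at b′ → b′ ≼ b
    below {b′} y∈ with col b ℕ.≤? col b′ | b ≟ᵇ b′
    ... | _      | yes refl = inj₁ refl
    ... | yes le | no ne    = contradiction (b′ , y∈ , le , ne) ∄b
    ... | no ¬le | no _     = inj₂ (ℕ.≰⇒> ¬le)
    left : ∀ {b″} → x Subset.∈ F at b″ → b ≼ b″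
    left {b″} x∈″ with ℕ.m≤n⇒m<n∨m≡n (leftmost b″ x∈″)
    ... | inj₁ lt = inj₂ lt
    ... | inj₂ eq = inj₁ (columnsDistinct b b″ x eq x∈ x∈″)
    y⊲x : lookup (occurrences F) y ⊲ lookup (occurrences F) x
    y⊲x b′∈ b″∈ = ≼-trans (below (∈-occurrences⁻ F b′∈)) (left (∈-occurrences⁻ F b″∈))

-- Permutations of terms and formal sums

module _ (R : A → B → Set) (f : A → A′) (g : B → A′) (value : ∀ {x y} → R x y → f x ≡ g y)
  (functional : ∀ {x y y′} → R x y → R x y′ → y ≡ y′)
  (injective : ∀ {x x′ y} → R x y → R x′ y → x ≡ x′) where

  -- The partner of the head is taken out of `ys`; `functional` and `injective` keep the remaining
  -- lists in correspondence. The bijection enters as a relation because each direction comes as an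
  -- existence statement.
  map-↭-map : ∀ xs ys → Unique xs → Unique ys →
    (∀ {x} → x ∈ xs → ∃[ y ] y ∈ ys × R x y) → (∀ {y} → y ∈ ys → ∃[ x ] x ∈ xs × R x y) →
    List.map f xs ↭ List.map g ys
  map-↭-map [] []      _ _ _ _ = ↭-refl
  map-↭-map [] (y ∷ _) _ _ _ back with () ← proj₁ (proj₂ (back (here refl)))
  map-↭-map (x ∷ xs) ys (x∉ ∷ uxs) uys forth back with forth (here refl)
  ... | y , y∈ , r with ∈-∃++ y∈
  ...   | ys₁ , ys₂ , refl =
    ↭-trans (subst (λ z → List.map f (x ∷ xs) ↭ z ∷ List.map g (ys₁ ++ ys₂)) (value r)
      (prep (f x) (map-↭-map xs (ys₁ ++ ys₂) uxs (tail-unique ys₁ uys) forth′ back′)))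
      (↭-sym (↭.map⁺ g (↭.shift y ys₁ ys₂)))
    where
    tail-unique : ∀ ys₁ → Unique (ys₁ ++ y ∷ ys₂) → Unique (ys₁ ++ ys₂)
    tail-unique []        (_ ∷ u) = u
    tail-unique (z ∷ ys₁) (h ∷ u) = LAll.tabulate (λ w∈ → LAll.lookup h (insert-∈ ys₁ w∈)) ∷ tail-unique ys₁ u
      where
      insert-∈ : ∀ ys₁ {w} → w ∈ ys₁ ++ ys₂ → w ∈ ys₁ ++ y ∷ ys₂
      insert-∈ ys₁ w∈ with ∈-++⁻ ys₁ w∈
      ... | inj₁ p = ∈-++⁺ˡ p
      ... | inj₂ p = ∈-++⁺ʳ ys₁ (there p)
    y∉ : ∀ ys₁ → Unique (ys₁ ++ y ∷ ys₂) → ¬ y ∈ ys₁ ++ ys₂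
    y∉ []        (h ∷ _) y∈          = LAll.lookup h y∈ refl
    y∉ (z ∷ ys₁) (h ∷ _) (here refl) = LAll.lookup h (∈-++⁺ʳ ys₁ (here refl)) refl
    y∉ (z ∷ ys₁) (_ ∷ u) (there y∈)  = y∉ ys₁ u y∈
    forth′ : ∀ {x′} → x′ ∈ xs → ∃[ y′ ] y′ ∈ ys₁ ++ ys₂ × R x′ y′
    forth′ x′∈ with forth (there x′∈)
    ... | y′ , y′∈ , r′ with ∈-++⁻ ys₁ y′∈
    ...   | inj₁ p           = y′ , ∈-++⁺ˡ p , r′
    ...   | inj₂ (there p)   = y′ , ∈-++⁺ʳ ys₁ p , r′
    ...   | inj₂ (here refl) = contradiction (injective r r′) (LAll.lookup x∉ x′∈)
    back′ : ∀ {y′} → y′ ∈ ys₁ ++ ys₂ → ∃[ x′ ] x′ ∈ xs × R x′ y′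
    back′ {y′} y′∈ with back (old (∈-++⁻ ys₁ y′∈))
      where
      old : y′ ∈ ys₁ ⊎ y′ ∈ ys₂ → y′ ∈ ys₁ ++ y ∷ ys₂
      old (inj₁ p) = ∈-++⁺ˡ p
      old (inj₂ p) = ∈-++⁺ʳ ys₁ (there p)
    ... | x′ , there x′∈ , r′ = x′ , x′∈ , r′
    ... | x′ , here refl , r′ =
      contradiction (subst (_∈ ys₁ ++ ys₂) (functional r′ r) y′∈) (y∉ ys₁ uys)

module _ (h : A → List B) where

  fibre : A → List (A × B)
  fibre x = List.map (x ,_) (h x)

  ∈-fibre⁻ : ∀ {x p} → p ∈ fibre x → proj₁ p ≡ x × proj₂ p ∈ h x
  ∈-fibre⁻ p∈ with ∈-map⁻ _ p∈
  ... | _ , y∈ , refl = refl , y∈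

  ∈-concatMap-fibre⁺ : ∀ {xs x y} → x ∈ xs → y ∈ h x → (x , y) ∈ concatMap fibre xs
  ∈-concatMap-fibre⁺ x∈ y∈ = ∈-concat⁺′ (∈-map⁺ (_ ,_) y∈) (∈-map⁺ fibre x∈)

  ∈-concatMap-fibre⁻ : ∀ xs {x y} → (x , y) ∈ concatMap fibre xs → x ∈ xs × y ∈ h x
  ∈-concatMap-fibre⁻ (z ∷ xs) p∈ with ∈-++⁻ (fibre z) p∈
  ... | inj₂ q = let (x∈ , y∈) = ∈-concatMap-fibre⁻ xs q in there x∈ , y∈
  ... | inj₁ q with ∈-fibre⁻ q
  ...   | refl , y∈ = here refl , y∈

  concatMap-fibre-unique : ∀ {xs} → Unique xs → (∀ x → Unique (h x)) → Unique (concatMap fibre xs)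
  concatMap-fibre-unique u uh = concatMap-unique u
    (λ x → Unique.map⁺ (λ { refl → refl }) (uh x))
    (λ p∈ p∈′ → trans (sym (proj₁ (∈-fibre⁻ p∈))) (proj₁ (∈-fibre⁻ p∈′)))

≈-↭ : {p q : Poly n} → p ↭ q → p ≈ q
≈-↭ ↭.refl m = refl
≈-↭ (prep (c , m′) p↭q) m = cong (λ s → if does (m ≟ᵐ m′) then c ℤ.+ s else s) (≈-↭ p↭q m)
≈-↭ {q = _ ∷ _ ∷ q} (swap (c , k) (d , l) p↭q) m rewrite ≈-↭ p↭q m with does (m ≟ᵐ k) | does (m ≟ᵐ l)
... | true  | true  = CommutativeSemigroup.x∙yz≈y∙xz ℤ.+-commutativeSemigroup c d (coeff q m)
... | true  | false = refl
... | false | true  = refl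
... | false | false = refl
≈-↭ (↭.trans p↭q q↭r) m = trans (≈-↭ p↭q m) (≈-↭ q↭r m)

term : ℕ → Vec ℕ n → ℤ × Monomial n
term k e = 1ℤ , k , e

replicate-+ : (e : Vec ℕ n) → Vec.zipWith _+_ (Vec.replicate n 0) e ≡ e
replicate-+ = Vec.zipWith-identityˡ ℕ.+-identityˡ

monomial-term : ∀ k (e : Vec ℕ n) → β^ k ⊗ 𝐱^ e ≡ [ term k e ]
monomial-term k e = cong₂ (λ k e → [ term k e ]) (ℕ.+-identityʳ k) (replicate-+ e)

∑-map : {f : A → Poly n} {t : A → ℤ × Monomial n} → (∀ x → f x ≡ [ t x ]) →
        ∀ xs → ∑ xs f ≡ List.map t xs
∑-map h []       = refl
∑-map h (x ∷ xs) = cong₂ _++_ (h x) (∑-map h xs)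

∑-concatMap : {f : A → Poly n} {h : A → List B} {t : B → ℤ × Monomial n} →
              (∀ x → f x ≡ List.map t (h x)) → ∀ xs → ∑ xs f ≡ List.map t (concatMap h xs)
∑-concatMap eq [] = refl
∑-concatMap {h = h} {t} eq (x ∷ xs) =
  trans (cong₂ _++_ (eq x) (∑-concatMap eq xs)) (sym (List.map-++ t (h x) (concatMap h xs)))

lascouxAtom-terms : (a : Vec ℕ n) →
  lascouxAtom a ≡ List.map (λ F → term (exᶠ F) (wt F)) (SSF a)
lascouxAtom-terms a = ∑-map (λ F → monomial-term (exᶠ F) (wt F)) (SSF a)

β^⊗kaon-terms : ∀ k (w : Vec ℕ n) →
  β^ k ⊗ kaon w ≡ List.map (λ b → term (k + ex b) (underlying b)) (mesonicGlides w)
β^⊗kaon-terms k w = begin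
  β^ k ⊗ kaon w
    ≡⟨ cong (β^ k ⊗_) (∑-map (λ b → monomial-term (ex b) (underlying b)) bs) ⟩
  List.map shift (List.map (λ b → term (ex b) (underlying b)) bs) ++ []
    ≡⟨ List.++-identityʳ _ ⟩
  List.map shift (List.map (λ b → term (ex b) (underlying b)) bs)
    ≡⟨ List.map-∘ bs ⟨
  List.map (λ b → shift (term (ex b) (underlying b))) bs
    ≡⟨ List.map-cong (λ b → cong (term (k + ex b)) (replicate-+ (underlying b))) bs ⟩
  List.map (λ b → term (k + ex b) (underlying b)) bs ∎
  where
  open ≡-Reasoning
  bs = mesonicGlides w
  shift : ℤ × Monomial _ → ℤ × Monomial _
  shift (c , l , e) = 1ℤ ℤ.* c , k + l , Vec.zipWith _+_ (Vec.replicate _ 0) e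

-- The bijection and the expansion into kaons

module _ (a : Vec ℕ n) where

  open Splitting {Box a} col _≟ᵇ_
  open Semistandard using (columnsDistinct; nonempty)

  Refines : Filling n a → Filling n a × Komposition n → Set
  Refines F (T , b) = Coarsens [] (occurrences F) b (occurrences T)

  glides : Filling n a → List (Komposition n)
  glides T = mesonicGlides (wt T)

  pairs : List (Filling n a × Komposition n)
  pairs = concatMap (fibre glides) (A2P a)

  ascending : ∀ {F : Filling n a} → Semistandard F → All Ascending (occurrences F)
  ascending {F} S = occurrences-ascending F (columnsDistinct S)

  coarsen : ∀ {F} → Semistandard F → ∃₂ λ T b →
    Refines F (T , b) × Semistandard T × MesonHighest T × MesonicGlide (wt T) b
  coarsen {F} S with coarsening-exists [] (occurrences F) [] (ascending S) (inj₁ refl)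
  ... | b , L , r , asc , tight = T , b , r′ , S′ , tight⇒mesonHighest S′ (subst Tight eq tight) ,
    glide⇒mesonic (subst (Glide 0 b) (occurrences-length T) (coarsens⇒glide r′))
    where
    T  = assemble L
    eq = sym (occurrences-assemble asc)
    r′ = subst (Coarsens [] (occurrences F) b) eq r
    S′ = Raises.coarse (coarsens⇒raises F T r′ (subst (All Ascending) eq asc)) S

  refine : ∀ {T b} → Semistandard T → MesonicGlide (wt T) b →
           ∃[ F ] Refines F (T , b) × Semistandard F
  refine {T} {b} S G with refinement-exists (occurrences T)
    (subst (Glide 0 b) (sym (occurrences-length T)) (mesonic⇒glide G))
  ... | [] , L , refl , r = F , r′ , Raises.fine (coarsens⇒raises F T r′ (ascending S)) S
    where
    F  = assemble L
    r′ = subst (λ L → Coarsens [] L b (occurrences T))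
               (sym (occurrences-assemble (proj₂ (coarsens-asc r (ascending S))))) r

  ∣a∣≤∣wt∣ : ∀ {T : Filling n a} → Semistandard T → ∣ a ∣ ℕ.≤ ∣ wt T ∣
  ∣a∣≤∣wt∣ {T} S = subst (ℕ._≤ ∣ wt T ∣) (length-boxes a)
    (length≤sum-filters (λ x b → x ∈? T at b) (nonempty S) (boxes a))

  pairTerm : Filling n a × Komposition n → ℤ × Monomial n
  pairTerm (T , b) = term (∣ wt T ∣ ∸ ∣ a ∣ + ex b) (underlying b)

  refines-term : ∀ {F T b} → Refines F (T , b) → Semistandard T → term (exᶠ F) (wt F) ≡ pairTerm (T , b)
  refines-term {F} {T} {b} r S = cong₂ term
    (trans (cong (_∸ ∣ a ∣) weight) (ℕ.+-∸-comm (ex b) (∣a∣≤∣wt∣ S)))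
    (trans (sym (occurrences-length F)) (coarsens-size r))
    where
    weight : ∣ wt F ∣ ≡ ∣ wt T ∣ + ex b
    weight = subst₂ (λ v w → ∣ v ∣ ≡ ∣ w ∣ + ex b) (occurrences-length F) (occurrences-length T)
      (trans (sym (ℕ.+-identityʳ _)) (coarsens-weight r))

  -- `Refines` alone is not functional, as every filling refines itself with all entries black.
  -- Recording that the coarse filling is semistandard and meson-highest makes the pair unique.
  record Destandardizes (F : Filling n a) (p : Filling n a × Komposition n) : Set where
    constructor destandardizes
    field
      refines   : Refines F p
      fineSS    : Semistandard F
      coarseSS  : Semistandard (proj₁ p)
      highest   : MesonHighest (proj₁ p)

  destandardizes-term : ∀ {F p} → Destandardizes F p → term (exᶠ F) (wt F) ≡ pairTerm p
  destandardizes-term {F} {T , _} (destandardizes r _ S _) = refines-term {F} {T} r S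

  destandardizes-functional : ∀ {F p q} → Destandardizes F p → Destandardizes F q → p ≡ q
  destandardizes-functional {p = T , _} {T′ , _} (destandardizes r _ S M) (destandardizes r′ _ S′ M′) =
    let (b≡b′ , L≡L′) = coarsening-unique r r′ (ascending S) (ascending S′)
                          (mesonHighest⇒tight S M) (mesonHighest⇒tight S′ M′)
    in cong₂ _,_ (occurrences-injective T T′ L≡L′) b≡b′

  destandardizes-injective : ∀ {F G p} → Destandardizes F p → Destandardizes G p → F ≡ G
  destandardizes-injective {F} {G} (destandardizes r _ _ _) (destandardizes r′ _ _ _) =
    occurrences-injective F G (proj₂ (refinement-unique r r′))

  SSF-↭-pairs : List.map (λ F → term (exᶠ F) (wt F)) (SSF a) ↭ List.map pairTerm pairs
  SSF-↭-pairs = map-↭-map Destandardizes _ pairTerm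
    destandardizes-term destandardizes-functional destandardizes-injective
    (SSF a) pairs (SSF-unique a) (concatMap-fibre-unique glides (A2P-unique a) (λ T → mesonicGlides-unique (wt T)))
    (λ {F} F∈ → let S = SSF-sound F F∈ ; (T , b , r , S′ , M , G) = coarsen S in
      (T , b) , ∈-concatMap-fibre⁺ glides (A2P-complete T S′ M) (mesonicGlides-complete (wt T) b G) ,
      destandardizes r S S′ M)
    (λ { {T , b} p∈ → let (T∈ , b∈) = ∈-concatMap-fibre⁻ glides (A2P a) p∈ ; (S , M) = A2P-sound T T∈
                          (F , r , S′) = refine S (mesonicGlides-sound (wt T) b b∈) in
      F , SSF-complete F S′ , destandardizes r S′ S M })

  lascouxAtom-expansion : lascouxAtom a ≈ ∑[ T ← A2P a ] (β^ (∣ wt T ∣ ∸ ∣ a ∣) ⊗ kaon (wt T))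
  lascouxAtom-expansion = subst₂ _≈_ (sym (lascouxAtom-terms a)) (sym (∑-concatMap
    (λ T → trans (β^⊗kaon-terms (∣ wt T ∣ ∸ ∣ a ∣) (wt T)) (List.map-∘ (mesonicGlides (wt T)))) (A2P a)))
    (≈-↭ SSF-↭-pairs)

∑-mapˡ : (f : B → Poly n) (g : A → B) → ∀ xs → ∑ (List.map g xs) f ≡ ∑ xs (f ∘ g)
∑-mapˡ f g []       = refl
∑-mapˡ f g (x ∷ xs) = cong (f (g x) ⊕_) (∑-mapˡ f g xs)

theorem3p12 : (n : ℕ) .{{_ : NonZero n}} (a : Vec ℕ n) →
    (lascouxAtom a ≈ ∑[ T ← A2P a ] (β^ (∣ wt T ∣ ∸ ∣ a ∣) ⊗ kaon (wt T)))
    × (Σ[ c ∈ List (ℕ × Vec ℕ n) ] lascouxAtom a ≈ ∑ c (λ (k , b) → β^ k ⊗ kaon b))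
theorem3p12 n a = lascouxAtom-expansion a ,
  -- Positivity is witnessed by a list with repetitions: one power of β and one kaon, with
  -- coefficient 1, for each meson-highest filling.
  List.map (λ T → ∣ wt T ∣ ∸ ∣ a ∣ , wt T) (A2P a) ,
  subst (lascouxAtom a ≈_) (sym (∑-mapˡ _ _ (A2P a))) (lascouxAtom-expansion a)
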